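{- Let $F$ be a minimally unsatisfiable clause-set with deficiency $\delta(F) = c(F)-n(F) = 2$. Then any two elements of $\mathrm{sDP}(F)$ are isomorphic.
   Context: Literals are variables $v$ and complements $\overline{v}$; a clause is a finite set of literals with no complementary pair; a clause-set is a finite set of clauses; $\mathrm{var}(F)$ is the set of variables of $F$, $n(F)=|\mathrm{var}(F)|$, $c(F)=|F|$; $\mathrm{ldeg}_F(x)$ is the number of clauses of $F$ containing literal $x$. $\mathrm{DP}_v(F) := \{C \in F : v \notin \mathrm{var}(C)\} \cup \{(C \cup D)\setminus\{v,\overline{v}\} : C, D \in F,\ C \cap \overline{D} = \{v\}\}$. $\mathrm{MU}$ is the set of minimally unsatisfiable clause-sets. A variable $v$ is singular for $F$ if $\min(\mathrm{ldeg}_F(v),\mathrm{ldeg}_F(\overline{v}))=1$; $F$ is nonsingular if it has none. A singular DP-reduction step is $F\leadsto \mathrm{DP}_v(F)$ for $F\in\mathrm{MU}$ and $v$ singular for $F$. $\mathrm{sDP}(F)$ is the set of nonsingular $F'\in\mathrm{MU}$ obtainable from $F$ by zero or more singular DP-reduction steps. Clause-sets $F,G$ are isomorphic if there is a bijection on literals commuting with complementation mapping the clauses of $F$ exactly onto the clauses of $G$. -}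

module Defs where

open import Level using (Level; _⊔_)
open import Data.Bool.Base using (Bool; true; false; not)
open import Data.Bool.Properties using (not-involutive) renaming (_≟_ to _≟ᴮ_)
open import Data.Integer.Base using (ℤ; +_; _-_)
open import Data.List.Base using (List; []; _∷_; [_]; _++_; map; filter; concatMap; length; deduplicate)
open import Data.List.Membership.Propositional.Properties using (∈-map⁺; ∈-map⁻; ∈-filter⁺; ∈-filter⁻; ∈-++⁻)
open import Data.List.Relation.Unary.Any using (here; there)
open import Data.Nat.Base using (ℕ; _⊓_)
open import Data.Product.Base using (_×_; _,_; proj₁; proj₂; ∃; ∃-syntax)
open import Data.Product.Properties using (≡-dec)
open import Data.Sum.Base using (inj₁; inj₂)
open import Function.Base using (_∘_; id)
open import Function.Bundles using (_↔_; Inverse)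
open import Relation.Binary.Bundles using (DecSetoid)
open import Relation.Binary.Construct.Closure.ReflexiveTransitive using (Star)
import Relation.Binary.Construct.Interior.Symmetric as SymInterior
import Relation.Binary.Construct.On as On
open import Relation.Binary.Core using (Rel)
open import Relation.Binary.Definitions using (Decidable; DecidableEquality)
open import Relation.Binary.PropositionalEquality using (_≡_; refl; sym; trans; cong; subst)
import Relation.Binary.PropositionalEquality.Properties as ≡
open import Relation.Nullary.Decidable using (Dec; yes; no; ¬?)
open import Relation.Nullary.Negation using (¬_; contradiction)
import Data.List.Membership.DecSetoid
import Data.List.Relation.Binary.Subset.DecSetoid

-- A finite set is a list, regarded up to having the same members; order and
-- repetitions are irrelevant, so cardinality counts distinct members.

module FiniteSets {c ℓ} (S : DecSetoid c ℓ) where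

  open DecSetoid S using (Carrier; _≟_)
  open Data.List.Membership.DecSetoid S public using (_∈_; _∉_; _∈?_; _∉?_)
  open Data.List.Relation.Binary.Subset.DecSetoid S public using (_⊆_; _⊈_; _⊆?_)

  infix 4 _≐_ _≐?_

  _≐_ : Rel (List Carrier) (c ⊔ ℓ)
  _≐_ = SymInterior.SymInterior _⊆_

  _≐?_ : Decidable _≐_
  _≐?_ = SymInterior.decidable _⊆?_

  decSetoid : DecSetoid c (c ⊔ ℓ)
  decSetoid = record
    { _≈_              = _≐_
    ; isDecEquivalence = record
      { isEquivalence = SymInterior.isEquivalence {R = _⊆_} id (λ p q → q ∘ p)
      ; _≟_           = _≐?_
      }
    }

  card : List Carrier → ℕ
  card = length ∘ deduplicate _≟_

module ClauseSets {a} {V : Set a} (_≟ⱽ_ : DecidableEquality V) where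

  -- (v , true) is the variable v as a literal, (v , false) its complement.

  Literal : Set a
  Literal = V × Bool

  pos neg : V → Literal
  pos v = v , true
  neg v = v , false

  var : Literal → V
  var = proj₁

  complement : Literal → Literal
  complement (v , b) = v , not b

  _≟ᴸ_ : DecidableEquality Literal
  _≟ᴸ_ = ≡-dec _≟ⱽ_ _≟ᴮ_

  module Vars = FiniteSets (≡.decSetoid _≟ⱽ_)
  module Lits = FiniteSets (≡.decSetoid _≟ᴸ_)
  open Lits using (_∈_; _∉_)

  infixr 7 _∩_
  infixr 6 _∪_
  infixl 6 _∖_

  _∩_ _∪_ _∖_ : List Literal → List Literal → List Literal
  K ∩ L = filter (Lits._∈? L) K
  K ∪ L = K ++ L
  K ∖ L = filter (Lits._∉? L) K

  complements : List Literal → List Literal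
  complements = map complement

  record Clause : Set a where
    constructor clause
    field
      literals   : List Literal
      clash-free : ∀ {x} → x ∈ literals → complement x ∉ literals

  open Clause public

  vars : Clause → List V
  vars = map var ∘ literals

  -- Clauses are equal when they have the same literals; membership and
  -- inclusion for clause-sets are taken up to this equality.

  module Clauses = FiniteSets (On.decSetoid Lits.decSetoid literals)

  ClauseSet : Set a
  ClauseSet = List Clause

  open Clauses public
    using () renaming (_∈_ to _∈ᶜ_; _⊆_ to _⊆ᶜ_; _⊈_ to _⊈ᶜ_; _≐_ to _≐ᶜ_)

  n c : ClauseSet → ℕ
  n F = Vars.card (concatMap vars F)
  c F = Clauses.card F

  δ : ClauseSet → ℤ
  δ F = + c F - + n F

  ldeg : ClauseSet → Literal → ℕ
  ldeg F x = Clauses.card (filter (λ C → x Lits.∈? literals C) F)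

  Assignment : Set a
  Assignment = V → Bool

  _⊨_ : Assignment → Clause → Set a
  φ ⊨ C = ∃[ x ] x ∈ literals C × φ (var x) ≡ proj₂ x

  Satisfiable : ClauseSet → Set a
  Satisfiable F = ∃[ φ ] (∀ {C} → C ∈ᶜ F → φ ⊨ C)

  MU : ClauseSet → Set a
  MU F = ¬ Satisfiable F × (∀ G → G ⊆ᶜ F → F ⊈ᶜ G → Satisfiable G)

  Resolvable : V → Clause → Clause → Set a
  Resolvable v C D = literals C ∩ complements (literals D) Lits.≐ [ pos v ]

  resolvable? : ∀ v C D → Dec (Resolvable v C D)
  resolvable? v C D = literals C ∩ complements (literals D) Lits.≐? [ pos v ]

  complement-involutive : ∀ x → complement (complement x) ≡ x
  complement-involutive (v , b) = cong (v ,_) (not-involutive b)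

  resolvent : ∀ v C D → Resolvable v C D → Clause
  resolvent v C D r = clause (K ∖ vv̄) clash-free′
    where
    K vv̄ : List Literal
    K  = literals C ∪ literals D
    vv̄ = pos v ∷ neg v ∷ []

    clash⇒pos : ∀ {x} → x ∈ literals C → complement x ∈ literals D → x ≡ pos v
    clash⇒pos {x} x∈C x̄∈D with SymInterior.lhs≤rhs r
      (∈-filter⁺ (Lits._∈? complements (literals D)) x∈C
        (subst (_∈ complements (literals D)) (complement-involutive x)
          (∈-map⁺ complement x̄∈D)))
    ... | here x≡v = x≡v

    clash-free′ : ∀ {x} → x ∈ K ∖ vv̄ → complement x ∉ K ∖ vv̄
    clash-free′ {x} x∈ x̄∈
      with x∈K , x∉vv̄ ← ∈-filter⁻ (Lits._∉? vv̄) {xs = K} x∈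
         | x̄∈K , x̄∉vv̄ ← ∈-filter⁻ (Lits._∉? vv̄) {xs = K} x̄∈
      with ∈-++⁻ (literals C) x∈K | ∈-++⁻ (literals C) x̄∈K
    ... | inj₁ x∈C | inj₁ x̄∈C = clash-free C x∈C x̄∈C
    ... | inj₂ x∈D | inj₂ x̄∈D = clash-free D x∈D x̄∈D
    ... | inj₁ x∈C | inj₂ x̄∈D = x∉vv̄ (here (clash⇒pos x∈C x̄∈D))
    ... | inj₂ x∈D | inj₁ x̄∈C = x̄∉vv̄ (here (clash⇒pos x̄∈C
      (subst (_∈ literals D) (sym (complement-involutive x)) x∈D)))

  resolvents : V → Clause → Clause → ClauseSet
  resolvents v C D with resolvable? v C D
  ... | yes r = [ resolvent v C D r ]
  ... | no  _ = []

  DP : V → ClauseSet → ClauseSet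
  DP v F = filter (λ C → v Vars.∉? vars C) F
        ++ concatMap (λ C → concatMap (resolvents v C) F) F

  Singular : V → ClauseSet → Set
  Singular v F = ldeg F (pos v) ⊓ ldeg F (neg v) ≡ 1

  Nonsingular : ClauseSet → Set a
  Nonsingular F = ∀ v → ¬ Singular v F

  infix 4 _⇝_ _∈sDP_ _≅_

  data _⇝_ : Rel ClauseSet a where
    reduce : ∀ {F} v → MU F → Singular v F → F ⇝ DP v F

  -- The last component closes sDP under equality of clause-sets.

  _∈sDP_ : ClauseSet → ClauseSet → Set a
  F′ ∈sDP F = MU F′ × Nonsingular F′ × ∃[ G ] Star _⇝_ F G × G ≐ᶜ F′

  record LiteralBijection : Set a where
    field
      bijection  : Literal ↔ Literal
    open Inverse bijection public using (to; from; strictlyInverseʳ)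
    field
      commutes : ∀ x → to (complement x) ≡ complement (to x)

  rename : LiteralBijection → Clause → Clause
  rename α C = clause (map to (literals C)) clash-free′
    where
    open LiteralBijection α

    to-injective : ∀ {x y} → to x ≡ to y → x ≡ y
    to-injective {x} {y} eq =
      trans (sym (strictlyInverseʳ x)) (trans (cong from eq) (strictlyInverseʳ y))

    clash-free′ : ∀ {x} → x ∈ map to (literals C) → complement x ∉ map to (literals C)
    clash-free′ x∈ x̄∈
      with y , y∈C , refl ← ∈-map⁻ to x∈
      with z , z∈C , eq ← ∈-map⁻ to x̄∈ =
      clash-free C y∈C
        (subst (_∈ literals C) (sym (to-injective (trans (commutes y) eq))) z∈C)

  _≅_ : Rel ClauseSet a
  F ≅ G = ∃[ α ] map (rename α) F ≐ᶜ G

{-# OPTIONS --safe #-}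
module Submission where

-- A reduction of a singular variable v with main clause C (the only clause containing the literal
-- v) replaces the side clauses D, those containing the complement of v, by C ∪ D without v. Two
-- reductions at v and w commute if their main clauses are different. If both use the same C, and
-- some further variable is singular after the reduction at v, then the two can be connected by
-- reductions with different main clauses. Otherwise both results are nonsingular. They differ
-- only in whether the rest of C is added to the side clauses of v or to those of w, and adding it
-- to both yields again a nonsingular minimally unsatisfiable clause-set of deficiency 2. In such
-- a clause-set no literal occurs more than twice, so nothing was added, and exchanging v and w
-- (with appropriate signs) is an isomorphism.
--
-- The bound on the occurrences of a literal x in a nonsingular F with deficiency 2: the clauses of
-- F without x contain a set K that is minimally unsatisfiable with deficiency at least 1 once x is
-- set to true, so K itself has deficiency at least 0. If K used fewer variables than F, then
-- adding to K minimally unsatisfiable sets over the other variables would exhibit a singular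
-- variable of F. So K uses all n variables, and omits at most 2 of the n + 2 clauses.

open import Defs
open import Data.Bool.Base using (Bool; true; false; not; if_then_else_; _xor_)
open import Data.Bool.Properties using (not-involutive; not-¬) renaming (_≟_ to _≟ᴮ_)
open import Data.Fin.Base using (Fin; zero; suc)
open import Data.Fin.Properties using (all?; any?; _≟_)
open import Data.Fin.Subset renaming (∣_∣ to size)
open import Data.Fin.Subset.Properties
open import Data.List.Base as List using (List; []; _∷_; _++_; map; filter; concatMap; length; deduplicate)
open import Data.List.Membership.Propositional using (find; lose) renaming (_∈_ to _∈ₗ_; _∉_ to _∉ₗ_)
open import Data.List.Membership.Propositional.Properties using (∈-map⁺; ∈-map⁻; ∈-filter⁺; ∈-filter⁻; ∈-++⁺ˡ; ∈-++⁺ʳ; ∈-++⁻; ∈-concatMap⁺; ∈-concatMap⁻; ∈-lookup)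
import Data.List.Membership.Setoid.Properties as Membership
import Data.List.Relation.Unary.All as All
open import Data.List.Relation.Unary.AllPairs using (AllPairs; []; _∷_)
open import Data.List.Relation.Unary.Any using (here; there; index)
open import Data.List.Relation.Unary.Any.Properties using (lookup-index)
open import Data.List.Relation.Unary.Unique.DecSetoid.Properties using (deduplicate-!)
open import Data.Nat.Base using (ℕ; zero; suc; _+_; _≤_; _<_; z≤n; s≤s)
import Data.Nat.Properties as ℕ
open import Data.Nat.Tactic.RingSolver using (solve-∀)
open import Data.Product.Base using (_×_; _,_; proj₁; proj₂; ∃-syntax)
open import Data.Sum.Base using (_⊎_; inj₁; inj₂; [_,_]′)
open import Data.Vec.Base using (_∷_; []; lookup; tabulate; here; there)
open import Data.Vec.Functional using (updateAt)
open import Data.Vec.Functional.Properties using (updateAt-updates; updateAt-minimal)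
open import Data.Vec.Properties using (lookup∘tabulate; []=⇒lookup; lookup⇒[]=)
open import Function.Base using (_∘_; const; id)
open import Function.Bundles using (Inverse; mk↔ₛ′)
open import Function.Construct.Composition using (_↔-∘_)
open import Function.Construct.Identity using (↔-id)
open import Function.Construct.Symmetry using (↔-sym)
open import Relation.Binary.Bundles using (DecSetoid)
open import Relation.Binary.Construct.Closure.ReflexiveTransitive using (Star; ε; _◅_)
open import Relation.Binary.Construct.Interior.Symmetric using (_,_; lhs≤rhs; rhs≤lhs)
import Relation.Binary.Construct.On as On
open import Relation.Binary.Definitions using (DecidableEquality)
open import Relation.Binary.PropositionalEquality using (_≡_; _≢_; refl; sym; trans; cong; cong₂; subst; ≢-sym; module ≡-Reasoning)
import Relation.Binary.PropositionalEquality.Properties as ≡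
open import Relation.Nullary.Decidable using (Dec; yes; no; does; ¬?; _×-dec_; _⊎-dec_; _→-dec_; decidable-stable; dec-true; dec-false; map′)
open import Relation.Nullary.Negation using (¬_; contradiction)
open import Relation.Unary using (Decidable)

-- Two reductions sharing their main clause are the obstacle: the first removes that clause, and the
-- two results live on different variables, so confluence can hold only up to isomorphism. The
-- induction on the number of variables therefore compares all irreducible outcomes of two states
-- (`_∼_`). Deficiency 2 enters this induction through a single bound, `at-most-twice`. For the
-- counting, the incidence relation `E` is fixed and a clause-set is a pair of index subsets:
-- partial assignments and deletions only shrink the pair. Deficiencies are differences of sizes,
-- and inequalities between them are written additively. They rest on two facts: deficiency is
-- additive under extension, and a critical part has deficiency at least 1.

-- Finite subsets and assignments

module _ {n : ℕ} where

  abstract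

    ⁅_⁆? : ∀ {ℓ} {P : Fin n → Set ℓ} → Decidable P → Subset n
    ⁅ P? ⁆? = tabulate (λ x → does (P? x))

    ∈-⁅⁆?⁺ : ∀ {ℓ} {P : Fin n → Set ℓ} (P? : Decidable P) {x} → P x → x ∈ ⁅ P? ⁆?
    ∈-⁅⁆?⁺ P? {x} px =
      lookup⇒[]= x _ (trans (lookup∘tabulate (λ y → does (P? y)) x) (dec-true (P? x) px))

    ∈-⁅⁆?⁻ : ∀ {ℓ} {P : Fin n → Set ℓ} (P? : Decidable P) {x} → x ∈ ⁅ P? ⁆? → P x
    ∈-⁅⁆?⁻ P? {x} x∈ with P? x
                        | trans (sym (lookup∘tabulate (λ y → does (P? y)) x)) ([]=⇒lookup x∈)
    ... | yes px | _ = px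

  x∈p─q⁻ : ∀ (p q : Subset n) {x} → x ∈ p ─ q → x ∈ p × x ∉ q
  x∈p─q⁻ p q x∈ = p─q⊆p p q x∈ , λ x∈q → disjoint p q x∈ x∈q
    where
    disjoint : ∀ {k} (p q : Subset k) {x} → x ∈ p ─ q → x ∉ q
    disjoint (_ ∷ p) (inside ∷ q) (there x∈) (there x∈q) = disjoint p q x∈ x∈q
    disjoint (_ ∷ p) (outside ∷ q) (there x∈) (there x∈q) = disjoint p q x∈ x∈q

  x∈p-y⁻ : ∀ (p : Subset n) {x y} → x ∈ p - y → x ∈ p × x ≢ y
  x∈p-y⁻ p {x} {y} x∈ with x∈p , x∉ ← x∈p─q⁻ p ⁅ y ⁆ x∈ = x∈p , x∉⁅y⁆⇒x≢y x∉

size-∪ : ∀ {n} {p q : Subset n} → (∀ {x} → x ∈ p → x ∉ q) → size (p ∪ q) ≡ size p + size q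
size-∪ {p = []} {[]} _ = refl
size-∪ {p = outside ∷ p} {outside ∷ q} d = size-∪ (λ x∈p x∈q → d (there x∈p) (there x∈q))
size-∪ {p = inside ∷ p} {outside ∷ q} d = cong suc (size-∪ (λ x∈p x∈q → d (there x∈p) (there x∈q)))
size-∪ {p = outside ∷ p} {inside ∷ q} d =
  trans (cong suc (size-∪ (λ x∈p x∈q → d (there x∈p) (there x∈q)))) (sym (ℕ.+-suc (size p) (size q)))
size-∪ {p = inside ∷ p} {inside ∷ q} d = contradiction here (d here)

size-∪⁅⁆ : ∀ {n} {p : Subset n} {x} → x ∉ p → size (p ∪ ⁅ x ⁆) ≡ suc (size p)
size-∪⁅⁆ {p = p} {x} x∉p =
  trans (size-∪ (λ y∈p y∈ → x∉p (subst (_∈ p) (x∈⁅y⁆⇒x≡y x y∈) y∈p)))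
        (trans (cong (size p +_) (∣⁅x⁆∣≡1 x)) (ℕ.+-comm (size p) 1))

size-remove : ∀ {n} {p : Subset n} {x} → x ∈ p → size p ≡ suc (size (p - x))
size-remove {p = p} {x} x∈p = trans (cong size (⊆-antisym ⊆₁ ⊆₂)) (size-∪⁅⁆ (λ x∈ → proj₂ (x∈p-y⁻ p x∈) refl))
  where
  ⊆₁ : p ⊆ (p - x) ∪ ⁅ x ⁆
  ⊆₁ {y} y∈p with y ≟ x
  ... | yes refl = x∈p∪q⁺ (inj₂ (x∈⁅x⁆ x))
  ... | no y≢x = x∈p∪q⁺ (inj₁ (x∈p∧x≢y⇒x∈p-y y∈p y≢x))
  ⊆₂ : (p - x) ∪ ⁅ x ⁆ ⊆ p
  ⊆₂ y∈ with x∈p∪q⁻ (p - x) ⁅ x ⁆ y∈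
  ... | inj₁ y∈p-x = proj₁ (x∈p-y⁻ p y∈p-x)
  ... | inj₂ y∈x = subst (_∈ p) (sym (x∈⁅y⁆⇒x≡y x y∈x)) x∈p

not-≢ : ∀ {b c} → b ≢ c → b ≡ not c
not-≢ {false} {false} ne = contradiction refl ne
not-≢ {false} {true} ne = refl
not-≢ {true} {false} ne = refl
not-≢ {true} {true} ne = contradiction refl ne

merge : ∀ {n} → Subset n → (Fin n → Bool) → (Fin n → Bool) → Fin n → Bool
merge Z φ ψ j = if does (j ∈? Z) then φ j else ψ j

merge-∈ : ∀ {n} {Z : Subset n} φ ψ {j} → j ∈ Z → merge Z φ ψ j ≡ φ j
merge-∈ {Z = Z} φ ψ {j} j∈Z rewrite dec-true (j ∈? Z) j∈Z = refl

merge-∉ : ∀ {n} {Z : Subset n} φ ψ {j} → j ∉ Z → merge Z φ ψ j ≡ ψ j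
merge-∉ {Z = Z} φ ψ {j} j∉Z rewrite dec-false (j ∈? Z) j∉Z = refl

infixl 10 _[_≔_]
_[_≔_] : ∀ {n} → (Fin n → Bool) → Fin n → Bool → Fin n → Bool
φ [ v ≔ c ] = updateAt φ v (const c)

-- The clause-set consists of the rows in some A : Subset m, restricted to the variables in some
-- W : Subset n; E i b is the set of variables whose literal of sign b occurs in row i.
module Rows {m n : ℕ} (E : Fin m → Bool → Subset n) where

  Sat : (Fin n → Bool) → Subset n → Fin m → Set
  Sat φ W i = ∃[ j ] j ∈ W × j ∈ E i (φ j)

  Models : (Fin n → Bool) → Subset m → Subset n → Set
  Models φ A W = ∀ i → i ∈ A → Sat φ W i

  Unsat : Subset m → Subset n → Set
  Unsat A W = ∀ φ → ¬ Models φ A W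

  Occurs : Subset m → Fin n → Set
  Occurs A j = ∃[ i ] ∃[ c ] i ∈ A × j ∈ E i c

  -- The falsification of row `i` itself comes from unsatisfiability, by `not-sat`.
  FalsifiesOnly : (Fin n → Bool) → Subset m → Subset n → Fin m → Set
  FalsifiesOnly φ A W i = ∀ k → k ∈ A → k ≢ i → Sat φ W k

  -- Minimality makes the rows in `A` pairwise different even after restriction to `W`: of two equal
  -- ones, either could be deleted without gaining satisfiability. Together with `occurs`, this
  -- makes `size A` and `size W` the numbers of clauses and variables.
  record Critical (A : Subset m) (W : Subset n) : Set where
    field
      unsat   : Unsat A W
      minimal : ∀ {i} → i ∈ A → ∃[ φ ] FalsifiesOnly φ A W i
      occurs  : ∀ {j} → j ∈ W → Occurs A j

    not-sat : ∀ {i φ} → FalsifiesOnly φ A W i → ¬ Sat φ W i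
    not-sat {i} {φ} only sat = unsat φ case
      where
      case : ∀ k → k ∈ A → Sat φ W k
      case k k∈A with k ≟ i
      ... | yes refl = sat
      ... | no k≢i = only k k∈A k≢i

  open Critical public

  sat-cong : ∀ {φ ψ W i} → (∀ j → φ j ≡ ψ j) → Sat φ W i → Sat ψ W i
  sat-cong {i = i} eq (j , j∈W , j∈E) = j , j∈W , subst (λ c → j ∈ E i c) (eq j) j∈E

  sat? : ∀ φ W i → Dec (Sat φ W i)
  sat? φ W i = any? λ j → (j ∈? W) ×-dec (j ∈? E i (φ j))

  models? : ∀ φ A W → Dec (Models φ A W)
  models? φ A W = map′ (λ sat i → sat {i}) (λ sat {i} → sat i) (Lift? (sat? φ W) A)

  satisfiable? : ∀ A W → Dec (∃[ φ ] Models φ A W)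
  satisfiable? A W = map′
    (λ (S , sat) → lookup S , sat)
    (λ (φ , sat) → tabulate φ , λ i i∈A → sat-cong (λ j → sym (lookup∘tabulate φ j)) (sat i i∈A))
    (anySubset? (λ S → models? (lookup S) A W))

  occurs? : ∀ A j → Dec (Occurs A j)
  occurs? A j = any? λ i → map′ (λ { (inj₁ p) → true , p ; (inj₂ p) → false , p })
    (λ { (true , p) → inj₁ p ; (false , p) → inj₂ p })
    (((i ∈? A) ×-dec (j ∈? E i true)) ⊎-dec ((i ∈? A) ×-dec (j ∈? E i false)))

  record CriticalPart (B : Subset m) (V : Subset n) : Set where
    field
      A        : Subset m
      W        : Subset n
      critical : Critical A W
      A⊆B      : A ⊆ B
      W⊆V      : W ⊆ V
      covers   : ∀ {i j c} → i ∈ A → j ∈ V → j ∈ E i c → j ∈ W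

  minimal-unsat : ∀ k {B W} → size B ≤ k → Unsat B W →
    ∃[ A ] A ⊆ B × Unsat A W × (∀ {i} → i ∈ A → ∃[ φ ] FalsifiesOnly φ A W i)
  minimal-unsat k {B} {W} B≤k unsat
    with any? (λ i → (i ∈? B) ×-dec ¬? (satisfiable? (B - i) W))
  minimal-unsat zero B≤k unsat | yes (i , i∈B , _) =
    contradiction (ℕ.≤-trans (x∈p⇒∣p-x∣<∣p∣ i∈B) B≤k) λ ()
  minimal-unsat (suc k) B≤k unsat | yes (i , i∈B , ¬sat)
    with A , A⊆ , rest ← minimal-unsat k (ℕ.≤-pred (ℕ.≤-trans (x∈p⇒∣p-x∣<∣p∣ i∈B) B≤k))
                           (λ φ sat → ¬sat (φ , sat)) =
    A , (λ x∈A → p─q⊆p _ _ (A⊆ x∈A)) , rest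
  minimal-unsat k {B} {W} B≤k unsat | no all-sat =
    B , id , unsat , λ {i} i∈B →
      let φ , sat = decidable-stable (satisfiable? (B - i) W) λ ¬sat → all-sat (i , i∈B , ¬sat)
      in φ , λ k k∈B k≢i → sat k (x∈p∧x≢y⇒x∈p-y k∈B k≢i)

  abstract

    criticalPart : ∀ {B V} → Unsat B V → CriticalPart B V
    criticalPart {B} {V} unsat-B with minimal-unsat (size B) ℕ.≤-refl unsat-B
    ... | A , A⊆B , unsat-A , minimal-A = record
      { A = A ; W = W
      ; critical = record
        { unsat   = λ φ sat → unsat-A φ λ i i∈A → let j , j∈W , j∈E = sat i i∈A in j , W⊆V j∈W , j∈E
        ; minimal = λ i∈A → let φ , only = minimal-A i∈A in
            φ , λ k k∈A k≢i → let j , j∈V , j∈E = only k k∈A k≢i in j , covers k∈A j∈V j∈E , j∈E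
        ; occurs  = λ j∈W → proj₂ (∈-⁅⁆?⁻ W? j∈W)
        }
      ; A⊆B = A⊆B ; W⊆V = W⊆V ; covers = covers
      }
      where
      W? : ∀ j → Dec (j ∈ V × Occurs A j)
      W? j = (j ∈? V) ×-dec occurs? A j
      W : Subset n
      W = ⁅ W? ⁆?
      W⊆V : W ⊆ V
      W⊆V j∈W = proj₁ (∈-⁅⁆?⁻ W? j∈W)
      covers : ∀ {i j c} → i ∈ A → j ∈ V → j ∈ E i c → j ∈ W
      covers i∈A j∈V j∈E = ∈-⁅⁆?⁺ W? (j∈V , _ , _ , i∈A , j∈E)

  critical-⊆ : ∀ {A B W} → Critical A W → B ⊆ A → Unsat B W → A ⊆ B
  critical-⊆ {B = B} crit B⊆A unsat-B {i} i∈A with i ∈? B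
  ... | yes i∈B = i∈B
  ... | no i∉B = let φ , only = minimal crit i∈A in
    contradiction (λ k k∈B → only k (B⊆A k∈B) λ { refl → i∉B k∈B }) (unsat-B φ)

  -- Pure literals: if the sign `c` were absent, the witness of minimality for a row `i` containing
  -- `j` could be changed at `j` to `not c`. That satisfies `i`, and every row relying on `j`
  -- contains it with sign `not c` anyway.
  literal-occurs : ∀ {A W j} → Critical A W → j ∈ W → ∀ c → ∃[ i ] i ∈ A × j ∈ E i c
  literal-occurs {A} {W} {j} crit j∈W c
    with any? (λ i → (i ∈? A) ×-dec (j ∈? E i c))
  ... | yes found = found
  ... | no none with i , d , i∈A , j∈E ← occurs crit j∈W
                with φ , only ← minimal crit i∈A =
    contradiction sat (unsat crit (φ [ j ≔ not c ]))
    where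
    is-not-c : ∀ {k d} → k ∈ A → j ∈ E k d → d ≡ not c
    is-not-c k∈A j∈E = not-≢ λ { refl → none (_ , k∈A , j∈E) }
    at-j : ∀ {k d} → k ∈ A → j ∈ E k d → Sat (φ [ j ≔ not c ]) W k
    at-j {k} k∈A j∈E = j , j∈W , subst (λ d → j ∈ E k d)
      (trans (is-not-c k∈A j∈E) (sym (updateAt-updates j φ))) j∈E
    sat : ∀ k → k ∈ A → Sat (φ [ j ≔ not c ]) W k
    sat k k∈A with k ≟ i
    ... | yes refl = at-j i∈A j∈E
    ... | no k≢i with only k k∈A k≢i
    ...   | l , l∈W , l∈E with l ≟ j
    ...     | yes refl = at-j k∈A l∈E
    ...     | no l≢j = l , l∈W , subst (λ d → l ∈ E k d) (sym (updateAt-minimal l j φ l≢j)) l∈E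

  record Vars (K : Subset m) (V Z : Subset n) : Set where
    field
      within : Z ⊆ V
      met    : ∀ {j} → j ∈ Z → Occurs K j
      meets  : ∀ {i j c} → i ∈ K → j ∈ V → j ∈ E i c → j ∈ Z

  open Vars public

  -- The rows of `K` and `A` are disjoint, so are `Z` and `W`, and `Z ∪ W` consists of the variables
  -- of `K ∪ A`. Hence the deficiencies of `K` and `A` add up.
  record Extension (F K : Subset m) (V Z : Subset n) : Set where
    field
      A        : Subset m
      W        : Subset n
      critical : Critical A W
      A⊆F      : A ⊆ F
      K∩A≡∅    : ∀ {i} → i ∈ K → i ∉ A
      W⊆V      : W ⊆ V
      Z∩W≡∅    : ∀ {j} → j ∈ Z → j ∉ W
      vars     : Vars (K ∪ A) V (Z ∪ W)
      covers   : ∀ {i j c} → i ∈ A → j ∈ V → j ∉ Z → j ∈ E i c → j ∈ W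

  abstract

    critical-sat : ∀ {F V K Z i} → Critical F V → K ⊆ F → Vars K V Z → i ∈ F → i ∉ K →
      ∃[ φ ] Models φ K Z
    critical-sat {K = K} crit K⊆F varsK i∈F i∉K with φ , only ← minimal crit i∈F =
      φ , λ k k∈K → let j , j∈V , j∈E = only k (K⊆F k∈K) (λ { refl → i∉K k∈K })
                  in j , meets varsK k∈K j∈V j∈E , j∈E

  abstract

    -- A satisfying assignment of K leaves an unsatisfiable rest in the remaining variables.
    extend : ∀ {F V K Z i} → Critical F V → K ⊆ F → Vars K V Z → i ∈ F → i ∉ K → Extension F K V Z
    extend {F} {V} {K} {Z} crit K⊆F varsK i∈F i∉K = record
      { A = A ; W = W ; critical = critical
      ; A⊆F = A⊆F
      ; K∩A≡∅ = λ k∈K k∈A → proj₂ (∈-⁅⁆?⁻ B? (A⊆B k∈A)) (φ⊨K _ k∈K)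
      ; W⊆V = λ j∈W → p∩q⊆p V (∁ Z) (W⊆U j∈W)
      ; Z∩W≡∅ = λ j∈Z j∈W → x∈∁p⇒x∉p (p∩q⊆q V (∁ Z) (W⊆U j∈W)) j∈Z
      ; vars = record
        { within = λ j∈ → [ within varsK , (λ j∈W → p∩q⊆p V (∁ Z) (W⊆U j∈W)) ]′ (x∈p∪q⁻ Z W j∈)
        ; met = λ j∈ →
            [ (λ j∈Z → let k , c , k∈ , j∈E = met varsK j∈Z in k , c , x∈p∪q⁺ (inj₁ k∈) , j∈E)
            , (λ j∈W → let k , c , k∈ , j∈E = occurs critical j∈W in k , c , x∈p∪q⁺ (inj₂ k∈) , j∈E)
            ]′ (x∈p∪q⁻ Z W j∈)
        ; meets = λ i∈ j∈V j∈E → meets′ (x∈p∪q⁻ K A i∈) j∈V j∈E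
        }
      ; covers = λ i∈A j∈V j∉Z → covers i∈A (x∈p∩q⁺ (j∈V , x∉p⇒x∈∁p j∉Z))
      }
      where
      φ⊨ : ∃[ φ ] Models φ K Z
      φ⊨ = critical-sat crit K⊆F varsK i∈F i∉K
      φ : Fin n → Bool
      φ = proj₁ φ⊨
      φ⊨K : Models φ K Z
      φ⊨K = proj₂ φ⊨
      -- The rows satisfied by `φ` are dropped, among them all of `K`; this gives `K∩A≡∅`.
      B? : ∀ i → Dec (i ∈ F × ¬ Sat φ Z i)
      B? i = (i ∈? F) ×-dec ¬? (sat? φ Z i)
      sat-merge : ∀ ψ → Models ψ ⁅ B? ⁆? (V ∩ ∁ Z) → ∀ k → k ∈ F → Sat (merge Z φ ψ) V k
      sat-merge ψ ψ⊨ k k∈F with sat? φ Z k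
      ... | yes (j , j∈Z , j∈E) =
        j , within varsK j∈Z , subst (λ c → j ∈ E k c) (sym (merge-∈ φ ψ j∈Z)) j∈E
      ... | no ¬sat with j , j∈U , j∈E ← ψ⊨ k (∈-⁅⁆?⁺ B? (k∈F , ¬sat))
                    with j∈V , j∈∁Z ← x∈p∩q⁻ V (∁ Z) j∈U =
        j , j∈V , subst (λ c → j ∈ E k c) (sym (merge-∉ {Z = Z} φ ψ (x∈∁p⇒x∉p j∈∁Z))) j∈E
      open CriticalPart (criticalPart {B = ⁅ B? ⁆?} {V = V ∩ ∁ Z}
        (λ ψ ψ⊨ → unsat crit (merge Z φ ψ) (sat-merge ψ ψ⊨)))
        renaming (W⊆V to W⊆U)
      A⊆F : A ⊆ F
      A⊆F i∈A = proj₁ (∈-⁅⁆?⁻ B? (A⊆B i∈A))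
      meets′ : ∀ {i j c} → i ∈ K ⊎ i ∈ A → j ∈ V → j ∈ E i c → j ∈ Z ∪ W
      meets′ (inj₁ i∈K) j∈V j∈E = x∈p∪q⁺ (inj₁ (meets varsK i∈K j∈V j∈E))
      meets′ {j = j} (inj₂ i∈A) j∈V j∈E with j ∈? Z
      ... | yes j∈Z = x∈p∪q⁺ (inj₁ j∈Z)
      ... | no j∉Z = x∈p∪q⁺ (inj₂ (covers i∈A (x∈p∩q⁺ (j∈V , x∉p⇒x∈∁p j∉Z)) j∈E))

  -- K is a critical part of what remains of F when the literal (v , b) is set to true.
  record Splitting (F : Subset m) (V : Subset n) (v : Fin n) (b : Bool) : Set where
    field
      K        : Subset m
      Z        : Subset n
      K⊆F      : K ⊆ F
      vars     : Vars K V Z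
      v∈Z      : v ∈ Z
      avoids   : ∀ {i} → i ∈ K → v ∉ E i b
      critical : Critical K (Z - v)

  abstract

    split : ∀ {F V v} → Critical F V → v ∈ V → ∀ b → Splitting F V v b
    split {F} {V} {v} crit v∈V b = record
      { K = A ; Z = W ∪ ⁅ v ⁆
      ; K⊆F = A⊆F
      ; vars = record
        { within = λ j∈ → [ (λ j∈W → p─q⊆p V ⁅ v ⁆ (W⊆V j∈W))
                          , (λ j∈v → subst (_∈ V) (sym (x∈⁅y⁆⇒x≡y v j∈v)) v∈V) ]′ (x∈p∪q⁻ W ⁅ v ⁆ j∈)
        ; met = λ j∈ → [ occurs critical
                       , (λ j∈v → subst (Occurs A) (sym (x∈⁅y⁆⇒x≡y v j∈v)) v-occurs) ]′ (x∈p∪q⁻ W ⁅ v ⁆ j∈)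
        ; meets = meets′
        }
      ; v∈Z = x∈p∪q⁺ (inj₂ (x∈⁅x⁆ v))
      ; avoids = λ i∈A → proj₂ (∈-⁅⁆?⁻ B? (A⊆B i∈A))
      ; critical = subst (Critical A) (sym W∪v-v≡W) critical
      }
      where
      B? : ∀ i → Dec (i ∈ F × v ∉ E i b)
      B? i = (i ∈? F) ×-dec ¬? (v ∈? E i b)
      sat-update : ∀ ψ → Models ψ ⁅ B? ⁆? (V - v) → ∀ k → k ∈ F → Sat (ψ [ v ≔ b ]) V k
      sat-update ψ ψ⊨ k k∈F with v ∈? E k b
      ... | yes v∈E = v , v∈V , subst (λ c → v ∈ E k c) (sym (updateAt-updates v ψ)) v∈E
      ... | no v∉E with j , j∈ , j∈E ← ψ⊨ k (∈-⁅⁆?⁺ B? (k∈F , v∉E)) with j∈V , j≢v ← x∈p-y⁻ V j∈ =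
        j , j∈V , subst (λ c → j ∈ E k c) (sym (updateAt-minimal j v ψ j≢v)) j∈E
      open CriticalPart (criticalPart {B = ⁅ B? ⁆?} {V = V - v}
        (λ ψ ψ⊨ → unsat crit (ψ [ v ≔ b ]) (sat-update ψ ψ⊨)))
      A⊆F : A ⊆ F
      A⊆F i∈A = proj₁ (∈-⁅⁆?⁻ B? (A⊆B i∈A))
      v∉W : v ∉ W
      v∉W v∈W = proj₂ (x∈p-y⁻ V (W⊆V v∈W)) refl
      W∪v-v≡W : (W ∪ ⁅ v ⁆) - v ≡ W
      W∪v-v≡W = ⊆-antisym
        (λ j∈ → let j∈W∪v , j≢v = x∈p-y⁻ (W ∪ ⁅ v ⁆) j∈ in
          [ id , (λ j∈v → contradiction (x∈⁅y⁆⇒x≡y v j∈v) j≢v) ]′ (x∈p∪q⁻ W ⁅ v ⁆ j∈W∪v))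
        (λ j∈W → x∈p∧x≢y⇒x∈p-y (x∈p∪q⁺ (inj₁ j∈W)) λ { refl → v∉W j∈W })
      meets′ : ∀ {i j c} → i ∈ A → j ∈ V → j ∈ E i c → j ∈ W ∪ ⁅ v ⁆
      meets′ {j = j} i∈A j∈V j∈E with j ≟ v
      ... | yes refl = x∈p∪q⁺ (inj₂ (x∈⁅x⁆ v))
      ... | no j≢v = x∈p∪q⁺ (inj₁ (covers i∈A (x∈p∧x≢y⇒x∈p-y j∈V j≢v) j∈E))
      -- Without an occurrence of `v`, the part `A` would be unsatisfiable over all of `V`, hence
      -- equal to `F` by criticality; but `v` occurs in `F`.
      v-occurs : Occurs A v
      v-occurs with occurs? A v
      ... | yes occ = occ
      ... | no ¬occ with i , c , i∈F , v∈E ← occurs crit v∈V =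
        contradiction (i , c , critical-⊆ crit A⊆F unsat-A i∈F , v∈E) ¬occ
        where
        unsat-A : Unsat A V
        unsat-A φ φ⊨A = unsat critical φ λ i i∈A → let j , j∈V , j∈E = φ⊨A i i∈A in
          j , covers i∈A (x∈p∧x≢y⇒x∈p-y j∈V λ j≡v → ¬occ (i , _ , i∈A , subst (_∈ E i (φ j)) j≡v j∈E)) j∈E , j∈E

-- Minimally unsatisfiable clause-sets of small deficiency

module Counting {m n : ℕ} (E : Fin m → Bool → Subset n) where

  open Rows E

  module _ {F K V Z} (critF : Critical F V) (K⊆F : K ⊆ F) (ext : Extension F K V Z) where

    open Extension ext

    size-K∪A : size (K ∪ A) ≡ size K + size A
    size-K∪A = size-∪ K∩A≡∅

    size-Z∪W : size (Z ∪ W) ≡ size Z + size W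
    size-Z∪W = size-∪ Z∩W≡∅

    K∪A⊆F : K ∪ A ⊆ F
    K∪A⊆F i∈ = [ K⊆F , A⊆F ]′ (x∈p∪q⁻ K A i∈)

    nonempty-Z∪W : Nonempty Z → Nonempty (Z ∪ W)
    nonempty-Z∪W (z , z∈Z) = z , x∈p∪q⁺ (inj₁ z∈Z)

    Exhausted : Set
    Exhausted = F ⊆ K ∪ A

    V⊆Z∪W : Exhausted → V ⊆ Z ∪ W
    V⊆Z∪W F⊆ j∈V = let i , c , i∈F , j∈E = occurs critF j∈V in meets vars (F⊆ i∈F) j∈V j∈E

    size-F : Exhausted → size F ≡ size K + size A
    size-F F⊆ = trans (cong size (⊆-antisym F⊆ K∪A⊆F)) size-K∪A

    size-V : Exhausted → size V ≡ size Z + size W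
    size-V F⊆ = trans (cong size (⊆-antisym (V⊆Z∪W F⊆) (within vars))) size-Z∪W

    exhausted? : (∃[ i ] i ∈ F × i ∉ K ∪ A) ⊎ Exhausted
    exhausted? with any? (λ i → (i ∈? F) ×-dec ¬? (i ∈? K ∪ A))
    ... | yes found = inj₁ found
    ... | no none = inj₂ λ {i} i∈F → decidable-stable (i ∈? K ∪ A) λ i∉ → none (i , i∈F , i∉)

  -- Tarsi's lemma, size V < size F for critical F, is proved by induction on size V together with
  -- the fact that among the subsets K of F using at least one variable, K = F has the strictly
  -- largest deficiency: repeated extension of K adds critical sets with fewer variables.

  TarsiBelow : ℕ → Set
  TarsiBelow k = ∀ {A W} → Critical A W → size W < k → size W < size A

  -- The conclusion compares the deficiencies `size K` minus `size Z` and `size F` minus `size V`.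
  -- The bound `d` on the rows outside `K` drops with each extension, because `size W < size A`
  -- makes `A` nonempty.
  surplusBelow : ∀ d {F V K Z i} → TarsiBelow (size V) → Critical F V → K ⊆ F → Vars K V Z → Nonempty Z →
    i ∈ F → i ∉ K → size F ≤ size K + d → size K + size V < size F + size Z
  surplusBelow zero tarsi crit K⊆F varsK ne i∈F i∉K F≤ =
    contradiction (ℕ.≤-trans F≤ (ℕ.≤-reflexive (ℕ.+-identityʳ _)))
      (ℕ.<⇒≱ (p⊂q⇒∣p∣<∣q∣ (K⊆F , _ , i∈F , i∉K)))
  surplusBelow (suc d) {F} {V} {K} {Z} tarsi crit K⊆F varsK ne@(z , z∈Z) i∈F i∉K F≤ =
    by-cases (exhausted? crit K⊆F ext)
    where
    ext : Extension F K V Z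
    ext = extend crit K⊆F varsK i∈F i∉K
    open Extension ext
    -- An element of `Z` keeps `W` a proper subset of `V`, so Tarsi's lemma is available for `A` by
    -- induction.
    W<A : size W < size A
    W<A = tarsi critical (p⊂q⇒∣p∣<∣q∣ (W⊆V , z , within varsK z∈Z , Z∩W≡∅ z∈Z))
    K<K∪A : size K < size (K ∪ A)
    K<K∪A = begin-strict
      size K             ≡⟨ ℕ.+-identityʳ _ ⟨
      size K + 0         <⟨ ℕ.+-monoʳ-< (size K) (ℕ.≤-<-trans z≤n W<A) ⟩
      size K + size A     ≡⟨ size-K∪A crit K⊆F ext ⟨
      size (K ∪ A)         ∎
      where open ℕ.≤-Reasoning
    by-cases : _ → _
    by-cases (inj₁ (r , r∈F , r∉)) = ℕ.+-cancelʳ-< (size A) _ _ (begin-strict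
      (size K + size V) + size A    ≡⟨ shuffle (size K) (size V) (size A) ⟩
      (size K + size A) + size V    ≡⟨ cong (_+ size V) (size-K∪A crit K⊆F ext) ⟨
      size (K ∪ A) + size V          <⟨ surplusBelow d tarsi crit (K∪A⊆F crit K⊆F ext) vars
                                    (nonempty-Z∪W crit K⊆F ext ne) r∈F r∉ F≤′ ⟩
      size F + size (Z ∪ W)          ≡⟨ cong (size F +_) (size-Z∪W crit K⊆F ext) ⟩
      size F + (size Z + size W)    ≡⟨ ℕ.+-assoc (size F) (size Z) (size W) ⟨
      (size F + size Z) + size W    <⟨ ℕ.+-monoʳ-< (size F + size Z) W<A ⟩
      (size F + size Z) + size A    ∎)
      where
      open ℕ.≤-Reasoning
      shuffle : ∀ k v a → (k + v) + a ≡ (k + a) + v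
      shuffle = solve-∀
      F≤′ : size F ≤ size (K ∪ A) + d
      F≤′ = begin
        size F            ≤⟨ F≤ ⟩
        size K + suc d    ≡⟨ ℕ.+-suc (size K) d ⟩
        suc (size K) + d    ≤⟨ ℕ.+-monoˡ-≤ d K<K∪A ⟩
        size (K ∪ A) + d    ∎
    by-cases (inj₂ F⊆) = begin-strict
      size K + size V              ≡⟨ cong (size K +_) (size-V crit K⊆F ext F⊆) ⟩
      size K + (size Z + size W)    ≡⟨ shuffle (size K) (size Z) (size W) ⟩
      (size K + size Z) + size W    <⟨ ℕ.+-monoʳ-< (size K + size Z) W<A ⟩
      (size K + size Z) + size A    ≡⟨ shuffle′ (size K) (size Z) (size A) ⟩
      (size K + size A) + size Z    ≡⟨ cong (_+ size Z) (size-F crit K⊆F ext F⊆) ⟨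
      size F + size Z              ∎
      where
      open ℕ.≤-Reasoning
      shuffle : ∀ k z w → k + (z + w) ≡ (k + z) + w
      shuffle = solve-∀
      shuffle′ : ∀ k z a → (k + z) + a ≡ (k + a) + z
      shuffle′ = solve-∀

  -- The critical part has deficiency at least 1 over `Z - v`; counting `v` again costs 1.
  splitting-≤ : ∀ {F V v b} (s : Splitting F V v b) → TarsiBelow (size V) →
    size (Splitting.Z s) ≤ size (Splitting.K s)
  splitting-≤ {V = V} {v} s tarsi = begin
    size Z          ≡⟨ size-remove v∈Z ⟩
    suc (size (Z - v))  ≤⟨ tarsi critical Z-v<V ⟩
    size K          ∎
    where
    open ℕ.≤-Reasoning
    open Splitting s
    Z-v<V : size (Z - v) < size V
    Z-v<V = ℕ.<-≤-trans (x∈p⇒∣p-x∣<∣p∣ v∈Z) (p⊆q⇒∣p∣≤∣q∣ (within vars))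

  tarsiBelow : ∀ k → TarsiBelow k
  tarsiBelow (suc k) {F} {V} crit V<k with nonempty? V
  ... | no V≡∅ with nonempty? F
  ...   | no F≡∅ = contradiction (λ i i∈F → contradiction (i , i∈F) F≡∅) (unsat crit (const true))
  ...   | yes (i , i∈F) = begin-strict
    size V  ≡⟨ cong size (Empty-unique V≡∅) ⟩
    size (⊥ {n})  ≡⟨ ∣⊥∣≡0 n ⟩
    0  <⟨ s≤s z≤n ⟩
    suc (size (F - i)) ≡⟨ size-remove i∈F ⟨
    size F ∎
    where open ℕ.≤-Reasoning
  tarsiBelow (suc k) {F} {V} crit V<k | yes (v , v∈V)
    -- A row containing the literal set to true lies outside `K`, so the surplus is strict; since
    -- `size Z ≤ size K`, the term `size K` then cancels.
    with i , i∈F , v∈E ← literal-occurs crit v∈V true = ℕ.+-cancelˡ-< (size K) _ _ (begin-strict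
      size K + size V  <⟨ surplusBelow (size F) tarsi crit K⊆F vars (v , v∈Z) i∈F (λ i∈K → avoids i∈K v∈E) (ℕ.m≤n+m (size F) (size K)) ⟩
      size F + size Z  ≤⟨ ℕ.+-monoʳ-≤ (size F) (splitting-≤ s tarsi) ⟩
      size F + size K  ≡⟨ ℕ.+-comm (size F) (size K) ⟩
      size K + size F  ∎)
    where
    open ℕ.≤-Reasoning
    tarsi : TarsiBelow (size V)
    tarsi crit′ W<V = tarsiBelow k crit′ (ℕ.≤-trans W<V (ℕ.≤-pred V<k))
    s : Splitting F V v true
    s = split crit v∈V true
    open Splitting s

  tarsi : ∀ {A W} → Critical A W → size W < size A
  tarsi crit = tarsiBelow _ crit ℕ.≤-refl

  surplus : ∀ {F V K Z i} → Critical F V → K ⊆ F → Vars K V Z → Nonempty Z → i ∈ F → i ∉ K →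
    size K + size V < size F + size Z
  surplus {F} {K = K} crit K⊆F varsK ne i∈F i∉K =
    surplusBelow (size F) (λ crit′ _ → tarsi crit′) crit K⊆F varsK ne i∈F i∉K (ℕ.m≤n+m (size F) (size K))

  splitting-Z≤K : ∀ {F V v b} (s : Splitting F V v b) → size (Splitting.Z s) ≤ size (Splitting.K s)
  splitting-Z≤K s = splitting-≤ s (λ crit _ → tarsi crit)

  AtMostOnce : Subset m → Fin n → Bool → Set
  AtMostOnce F u b = ∀ i k → i ∈ F → k ∈ F → u ∈ E i b → u ∈ E k b → i ≡ k

  atMostOnce-⊆ : ∀ {F A u b} → (∀ {i} → i ∈ F → u ∈ E i b → i ∈ A) → AtMostOnce A u b → AtMostOnce F u b
  atMostOnce-⊆ into once i k i∈F k∈F u∈Ei u∈Ek = once i k (into i∈F u∈Ei) (into k∈F u∈Ek) u∈Ei u∈Ek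

  -- Deficiency 1 leaves no slack: after splitting at `(v , b)`, the deficiency is at least 0 for
  -- `K` and at least 1 for the extension `A`, so `K ∪ A` is all of `F` and `A` has deficiency
  -- exactly 1. If `W` is nonempty, recursion finds `u` in `W`, whose variables do not occur in `K`.
  -- If it is empty, `A` is a single row, and no other row can contain `(v , b)`. When this happens
  -- for both signs, `u` is `v`.
  once-in-each-sign : ∀ k {F V} → Critical F V → size F ≡ suc (size V) → Nonempty V → size V < k →
    ∃[ u ] u ∈ V × (∀ b → AtMostOnce F u b)
  once-in-each-sign (suc k) {F} {V} crit F≡1+V (v , v∈V) V<k = conclude (one-sign true) (one-sign false)
    where
    Goal : Set
    Goal = ∃[ u ] u ∈ V × (∀ b → AtMostOnce F u b)
    conclude : Goal ⊎ AtMostOnce F v true → Goal ⊎ AtMostOnce F v false → Goal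
    conclude (inj₁ g) _ = g
    conclude _ (inj₁ g) = g
    conclude (inj₂ t) (inj₂ f) = v , v∈V , λ { true → t ; false → f }
    one-sign : ∀ b → Goal ⊎ AtMostOnce F v b
    one-sign b with i , i∈F , v∈E ← literal-occurs crit v∈V b =
      continue (exhausted? crit K⊆F ext)
      where
      open ℕ.≤-Reasoning
      open Splitting (split crit v∈V b) renaming (critical to criticalK)
      Z≤K : size Z ≤ size K
      Z≤K = splitting-Z≤K (split crit v∈V b)
      ext : Extension F K V Z
      ext = extend crit K⊆F vars i∈F (λ i∈K → avoids i∈K v∈E)
      open Extension ext renaming (vars to varsK∪A)
      onlyA : F ⊆ K ∪ A → ∀ {u i c} → u ∈ W → i ∈ F → u ∈ E i c → i ∈ A
      onlyA F⊆ u∈W i∈F u∈E =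
        [ (λ i∈K → contradiction u∈W (Z∩W≡∅ (meets vars i∈K (W⊆V u∈W) u∈E))) , id ]′ (x∈p∪q⁻ K A (F⊆ i∈F))
      A≤1+W : F ⊆ K ∪ A → size A ≤ suc (size W)
      A≤1+W F⊆ = ℕ.+-cancelˡ-≤ (size K) _ _ (begin
        size K + size A          ≡⟨ size-F crit K⊆F ext F⊆ ⟨
        size F                   ≡⟨ F≡1+V ⟩
        suc (size V)             ≡⟨ cong suc (size-V crit K⊆F ext F⊆) ⟩
        suc (size Z + size W)    ≡⟨ ℕ.+-suc (size Z) (size W) ⟨
        size Z + suc (size W)    ≤⟨ ℕ.+-monoˡ-≤ (suc (size W)) Z≤K ⟩
        size K + suc (size W)    ∎)
      all-equal : size A ≤ 1 → ∀ {i k} → i ∈ A → k ∈ A → i ≡ k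
      all-equal A≤1 {i} {k} i∈A k∈A = decidable-stable (i ≟ k) λ i≢k → ℕ.<⇒≱ (begin-strict
        1                          ≤⟨ s≤s z≤n ⟩
        suc (size (A - i - k))     ≡⟨ size-remove (x∈p∧x≢y⇒x∈p-y k∈A (≢-sym i≢k)) ⟨
        size (A - i)               <⟨ x∈p⇒∣p-x∣<∣p∣ i∈A ⟩
        size A                     ∎) A≤1
      shuffle : ∀ v z w → suc v + (z + w) ≡ (z + suc w) + v
      shuffle = solve-∀
      finish : F ⊆ K ∪ A → Dec (Nonempty W) → Goal ⊎ AtMostOnce F v b
      finish F⊆ (no W≡∅) = inj₂ (atMostOnce-⊆
        (λ i∈F v∈E → [ (λ i∈K → contradiction v∈E (avoids i∈K)) , id ]′ (x∈p∪q⁻ K A (F⊆ i∈F)))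
        (λ _ _ i∈A k∈A _ _ → all-equal A≤1 i∈A k∈A))
        where
        A≤1 : size A ≤ 1
        A≤1 = subst (λ w → size A ≤ suc w) (trans (cong size (Empty-unique W≡∅)) (∣⊥∣≡0 n)) (A≤1+W F⊆)
      finish F⊆ (yes ne) with u , u∈W , once ← once-in-each-sign k critical
                                (ℕ.≤-antisym (A≤1+W F⊆) (tarsi critical)) ne
                                (ℕ.<-≤-trans (p⊂q⇒∣p∣<∣q∣ (W⊆V , v , v∈V , Z∩W≡∅ v∈Z)) (ℕ.≤-pred V<k)) =
        inj₁ (u , W⊆V u∈W , λ c → atMostOnce-⊆ (onlyA F⊆ u∈W) (once c))
      continue : (∃[ i ] i ∈ F × i ∉ K ∪ A) ⊎ F ⊆ K ∪ A → Goal ⊎ AtMostOnce F v b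
      continue (inj₁ (r , r∈F , r∉)) = contradiction
        (surplus crit (K∪A⊆F crit K⊆F ext) varsK∪A
          (nonempty-Z∪W crit K⊆F ext (v , v∈Z)) r∈F r∉)
        (ℕ.≤⇒≯ (begin
          size F + size (Z ∪ W)              ≡⟨ cong (size F +_) (size-Z∪W crit K⊆F ext) ⟩
          size F + (size Z + size W)         ≡⟨ cong (_+ (size Z + size W)) F≡1+V ⟩
          suc (size V) + (size Z + size W)   ≡⟨ shuffle (size V) (size Z) (size W) ⟩
          (size Z + suc (size W)) + size V   ≤⟨ ℕ.+-monoˡ-≤ (size V) (ℕ.+-mono-≤ Z≤K (tarsi critical)) ⟩
          (size K + size A) + size V         ≡⟨ cong (_+ size V) (size-K∪A crit K⊆F ext) ⟨
          size (K ∪ A) + size V              ∎))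
      continue (inj₂ F⊆) = finish F⊆ (nonempty? W)

-- Literal degrees in nonsingular clause-sets of deficiency 2

module Deficiency2 {m n : ℕ} (E : Fin m → Bool → Subset n) where

  open Rows E
  open Counting E

  ClashFree : Subset m → Subset n → Set
  ClashFree F V = ∀ {i j b} → i ∈ F → j ∈ V → j ∈ E i b → j ∉ E i (not b)

  Nonsingular : Subset m → Subset n → Set
  Nonsingular F V = ∀ {u} → u ∈ V → ∀ b → ¬ AtMostOnce F u b

  module _ {F V} (crit : Critical F V) (F≡2+V : size F ≡ 2 + size V) (nonsing : Nonsingular F V) where

    -- A proper extension of K with larger deficiency is all of F; the added part has
    -- deficiency 1, so it contains a singular variable of F.
    spans-if-Z<K : ∀ {K Z i} → K ⊆ F → Vars K V Z → Nonempty Z → i ∈ F → i ∉ K → size Z < size K → V ⊆ Z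
    spans-if-Z<K {K} {Z} K⊆F varsK ne i∈F i∉K Z<K {j} j∈V with j ∈? Z
    ... | yes j∈Z = j∈Z
    ... | no j∉Z = by-cases (exhausted? crit K⊆F ext)
      where
      open ℕ.≤-Reasoning
      ext : Extension F K V Z
      ext = extend crit K⊆F varsK i∈F i∉K
      open Extension ext
      shuffle : ∀ z w v → (2 + v) + (z + w) ≡ (suc z + suc w) + v
      shuffle = solve-∀
      by-cases : (∃[ i ] i ∈ F × i ∉ K ∪ A) ⊎ F ⊆ K ∪ A → j ∈ Z
      by-cases (inj₁ (r , r∈F , r∉)) = contradiction
        (surplus crit (K∪A⊆F crit K⊆F ext) vars (nonempty-Z∪W crit K⊆F ext ne) r∈F r∉)
        (ℕ.≤⇒≯ (begin
          size F + size (Z ∪ W)                ≡⟨ cong (size F +_) (size-Z∪W crit K⊆F ext) ⟩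
          size F + (size Z + size W)           ≡⟨ cong (_+ (size Z + size W)) F≡2+V ⟩
          (2 + size V) + (size Z + size W)     ≡⟨ shuffle (size Z) (size W) (size V) ⟩
          (suc (size Z) + suc (size W)) + size V ≤⟨ ℕ.+-monoˡ-≤ (size V) (ℕ.+-mono-≤ Z<K (tarsi critical)) ⟩
          (size K + size A) + size V           ≡⟨ cong (_+ size V) (size-K∪A crit K⊆F ext) ⟨
          size (K ∪ A) + size V                ∎))
      by-cases (inj₂ F⊆) =
        let u , u∈W , once = once-in-each-sign _ critical
              (ℕ.≤-antisym A≤1+W (tarsi critical)) (j , j∈W) ℕ.≤-refl
        in contradiction (atMostOnce-⊆ (onlyA u∈W) (once true)) (nonsing (W⊆V u∈W) true)
        where
        j∈W : j ∈ W
        j∈W = [ (λ j∈Z → contradiction j∈Z j∉Z) , id ]′ (x∈p∪q⁻ Z W (V⊆Z∪W crit K⊆F ext F⊆ j∈V))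
        A≤1+W : size A ≤ suc (size W)
        A≤1+W = ℕ.+-cancelˡ-≤ (size K) _ _ (begin
          size K + size A               ≡⟨ size-F crit K⊆F ext F⊆ ⟨
          size F                        ≡⟨ F≡2+V ⟩
          2 + size V                    ≡⟨ cong (2 +_) (size-V crit K⊆F ext F⊆) ⟩
          suc (suc (size Z + size W))   ≡⟨ ℕ.+-suc (suc (size Z)) (size W) ⟨
          suc (size Z) + suc (size W)   ≤⟨ ℕ.+-monoˡ-≤ (suc (size W)) Z<K ⟩
          size K + suc (size W)         ∎)
        onlyA : ∀ {u i} → u ∈ W → i ∈ F → u ∈ E i true → i ∈ A
        onlyA u∈W i∈F u∈E =
          [ (λ i∈K → contradiction u∈W (Z∩W≡∅ (meets varsK i∈K (W⊆V u∈W) u∈E))) , id ]′ (x∈p∪q⁻ K A (F⊆ i∈F))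

    module _ (clash-free : ClashFree F V) where

      missing-sign : ∀ {i j} → i ∈ F → j ∈ V → ∃[ b ] j ∉ E i b
      missing-sign {i} {j} i∈F j∈V with j ∈? E i true
      ... | yes j∈E = false , clash-free i∈F j∈V j∈E
      ... | no j∉E = true , j∉E

      -- After `spans-if-Z<K` only deficiency 0 of `K` remains. The added `A` then has deficiency 1
      -- if a clause is left over, and 2 otherwise. In the second case `once-in-each-sign` does not
      -- apply to `A`, and the search returns to `K`; the induction on `size K` serves this return.
      spans : ∀ k {K Z i} → K ⊆ F → Vars K V Z → Nonempty Z → i ∈ F → i ∉ K →
        size Z ≤ size K → size K < k → V ⊆ Z
      spans (suc k) {K} {Z} K⊆F varsK ne@(z , z∈Z) i∈F i∉K Z≤K K<k {j} j∈V with j ∈? Z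
      ... | yes j∈Z = j∈Z
      ... | no j∉Z = by-cases (exhausted? crit K⊆F ext)
        where
        open ℕ.≤-Reasoning
        ext : Extension F K V Z
        ext = extend crit K⊆F varsK i∈F i∉K
        open Extension ext
        K≡Z : size K ≡ size Z
        K≡Z = ℕ.≤-antisym (ℕ.≮⇒≥ λ Z<K → j∉Z (spans-if-Z<K K⊆F varsK ne i∈F i∉K Z<K j∈V)) Z≤K

        -- Only one clause r lies outside K ∪ A, and it misses one sign of the variable occurring
        -- once in each sign in A.
        one-left : ∀ {r} → r ∈ F → r ∉ K ∪ A → j ∈ Z
        one-left {r} r∈F r∉ =
          let u , u∈W , once = once-in-each-sign _ critical
                (ℕ.≤-antisym A≤1+W (tarsi critical)) (j , j∈W) ℕ.≤-refl
              b , u∉Er = missing-sign r∈F (W⊆V u∈W)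
          in contradiction (atMostOnce-⊆ (onlyA u∈W u∉Er) (once b)) (nonsing (W⊆V u∈W) b)
          where
          Z∪W<K∪A : size (Z ∪ W) < size (K ∪ A)
          Z∪W<K∪A = begin-strict
            size (Z ∪ W)       ≡⟨ size-Z∪W crit K⊆F ext ⟩
            size Z + size W    <⟨ ℕ.+-mono-≤-< Z≤K (tarsi critical) ⟩
            size K + size A    ≡⟨ size-K∪A crit K⊆F ext ⟨
            size (K ∪ A)       ∎
          V⊆ : V ⊆ Z ∪ W
          V⊆ = spans-if-Z<K (K∪A⊆F crit K⊆F ext) vars (nonempty-Z∪W crit K⊆F ext ne) r∈F r∉ Z∪W<K∪A
          j∈W : j ∈ W
          j∈W = [ (λ j∈Z → contradiction j∈Z j∉Z) , id ]′ (x∈p∪q⁻ Z W (V⊆ j∈V))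
          V≡Z∪W : size V ≡ size (Z ∪ W)
          V≡Z∪W = cong size (⊆-antisym V⊆ (within vars))
          K∪A≤1+V : size (K ∪ A) ≤ suc (size V)
          K∪A≤1+V = ℕ.≤-pred (begin-strict
            size (K ∪ A)       <⟨ p⊂q⇒∣p∣<∣q∣ (K∪A⊆F crit K⊆F ext , r , r∈F , r∉) ⟩
            size F             ≡⟨ F≡2+V ⟩
            2 + size V         ∎)
          A≤1+W : size A ≤ suc (size W)
          A≤1+W = ℕ.+-cancelˡ-≤ (size K) _ _ (begin
            size K + size A            ≡⟨ size-K∪A crit K⊆F ext ⟨
            size (K ∪ A)               ≤⟨ K∪A≤1+V ⟩
            suc (size V)               ≡⟨ cong suc V≡Z∪W ⟩
            suc (size (Z ∪ W))         ≡⟨ cong suc (size-Z∪W crit K⊆F ext) ⟩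
            suc (size Z + size W)      ≡⟨ ℕ.+-suc (size Z) (size W) ⟨
            size Z + suc (size W)      ≤⟨ ℕ.+-monoˡ-≤ (suc (size W)) Z≤K ⟩
            size K + suc (size W)      ∎)
          K∪A⊆F-r-s : ∀ {s} → s ∉ K ∪ A → K ∪ A ⊆ F - r - s
          K∪A⊆F-r-s s∉ x∈ = x∈p∧x≢y⇒x∈p-y
            (x∈p∧x≢y⇒x∈p-y (K∪A⊆F crit K⊆F ext x∈) λ { refl → r∉ x∈ }) λ { refl → s∉ x∈ }
          others : ∀ {s} → s ∈ F → s ≢ r → s ∈ K ∪ A
          others {s} s∈F s≢r = decidable-stable (s ∈? K ∪ A) λ s∉ →
            ℕ.<-irrefl refl (begin-strict
              suc (size V)                 ≡⟨ cong suc V≡Z∪W ⟩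
              suc (size (Z ∪ W))           ≤⟨ Z∪W<K∪A ⟩
              size (K ∪ A)                 ≤⟨ p⊆q⇒∣p∣≤∣q∣ (K∪A⊆F-r-s s∉) ⟩
              size (F - r - s)             <⟨ ℕ.n<1+n _ ⟩
              suc (size (F - r - s))       ≡⟨ size-remove (x∈p∧x≢y⇒x∈p-y s∈F s≢r) ⟨
              size (F - r)                 ≡⟨ ℕ.suc-injective (trans (sym (size-remove r∈F)) F≡2+V) ⟩
              suc (size V)                 ∎)
          onlyA : ∀ {u b i} → u ∈ W → u ∉ E r b → i ∈ F → u ∈ E i b → i ∈ A
          onlyA u∈W u∉Er i∈F u∈E =
            [ (λ i∈K → contradiction u∈W (Z∩W≡∅ (meets varsK i∈K (W⊆V u∈W) u∈E))) , id ]′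
              (x∈p∪q⁻ K A (others i∈F λ { refl → u∉Er u∈E }))

        -- A model of K ∪ ⁅ i ⁆ on Z, completed by an assignment of the remaining variables that
        -- falsifies only i in A, would satisfy F.
        unsat-with : F ⊆ K ∪ A → ∀ {i} → i ∈ A → Unsat (K ∪ ⁅ i ⁆) Z
        unsat-with F⊆ {i} i∈A φ φ⊨ with ψ , only ← minimal critical i∈A =
          unsat crit (merge Z φ ψ) λ k k∈F → row k (x∈p∪q⁻ K A (F⊆ k∈F))
          where
          on-Z : ∀ k → k ∈ K ∪ ⁅ i ⁆ → Sat (merge Z φ ψ) V k
          on-Z k k∈ = let l , l∈Z , l∈E = φ⊨ k k∈ in
            l , within varsK l∈Z , subst (λ c → l ∈ E k c) (sym (merge-∈ φ ψ l∈Z)) l∈E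
          row : ∀ k → k ∈ K ⊎ k ∈ A → Sat (merge Z φ ψ) V k
          row k (inj₁ k∈K) = on-Z k (x∈p∪q⁺ (inj₁ k∈K))
          row k (inj₂ k∈A) with k ≟ i
          ... | yes refl = on-Z k (x∈p∪q⁺ (inj₂ (x∈⁅x⁆ k)))
          ... | no k≢i = let l , l∈W , l∈E = only k k∈A k≢i in
            l , W⊆V l∈W , subst (λ c → l ∈ E k c) (sym (merge-∉ φ ψ λ l∈Z → Z∩W≡∅ l∈Z l∈W)) l∈E

        sat-K : ∃[ φ ] Models φ K Z
        sat-K = critical-sat crit K⊆F varsK i∈F i∉K

        -- If `A` avoided `Z`, it would be unsatisfiable over all of `V` and hence equal to `F`,
        -- leaving no room for the rows of `K`.
        meets-Z : F ⊆ K ∪ A → ∃[ i ] ∃[ l ] i ∈ A × l ∈ Z × (∃[ c ] l ∈ E i c)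
        meets-Z F⊆ with any? (λ i → any? λ l → (i ∈? A) ×-dec ((l ∈? Z) ×-dec occurs-in? i l))
          where
          occurs-in? : ∀ i l → Dec (∃[ c ] l ∈ E i c)
          occurs-in? i l with l ∈? E i true | l ∈? E i false
          ... | yes p | _ = yes (true , p)
          ... | no _ | yes p = yes (false , p)
          ... | no p | no q = no λ { (true , x) → p x ; (false , x) → q x }
        ... | yes found = found
        ... | no none = let k , _ , k∈K , _ = met varsK z∈Z in
          contradiction (critical-⊆ crit A⊆F unsat-A (K⊆F k∈K)) (K∩A≡∅ k∈K)
          where
          unsat-A : Unsat A V
          unsat-A φ φ⊨ = unsat critical φ λ k k∈A → let l , l∈V , l∈E = φ⊨ k k∈A in
            l , covers k∈A l∈V (λ l∈Z → none (k , l , k∈A , l∈Z , _ , l∈E)) l∈E , l∈E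

        -- A model φ of K falsifies the Z-part of every clause of A, so a literal over Z satisfied
        -- by φ occurs only in K. Hence the variable u occurring once in each sign in K ∪ ⁅ i₀ ⁆
        -- is singular in F, unless a smaller K₁ already serves.
        all-left : F ⊆ K ∪ A → j ∈ Z
        all-left F⊆ with i₀ , l , i₀∈A , l∈Z , c , l∈E ← meets-Z F⊆
                    with φ , φ⊨K ← sat-K = by-size (size K₁ ℕ.<? size K)
          where
          open CriticalPart (criticalPart (unsat-with F⊆ i₀∈A))
            renaming (A to M; W to Z₁; critical to critM; A⊆B to M⊆; W⊆V to Z₁⊆Z; covers to coversM)
          K₁ : Subset m
          K₁ = M - i₀
          M-i₀⊆K : ∀ {k} → k ∈ M → k ≢ i₀ → k ∈ K
          M-i₀⊆K k∈M k≢i₀ =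
            [ id , (λ k∈ → contradiction (x∈⁅y⁆⇒x≡y i₀ k∈) k≢i₀) ]′ (x∈p∪q⁻ K ⁅ i₀ ⁆ (M⊆ k∈M))
          K₁⊆K : K₁ ⊆ K
          K₁⊆K k∈ = let k∈M , k≢i₀ = x∈p-y⁻ M k∈ in M-i₀⊆K k∈M k≢i₀
          -- Since `φ` satisfies `K`, the unsatisfiability of `M` must use `i₀`.
          i₀∈M : i₀ ∈ M
          i₀∈M = decidable-stable (i₀ ∈? M) λ i₀∉M → unsat critM φ λ k k∈M →
            let l , l∈Z , l∈E = φ⊨K k (M-i₀⊆K k∈M λ { refl → i₀∉M k∈M })
            in l , coversM k∈M l∈Z l∈E , l∈E
          Z₁≤K₁ : size Z₁ ≤ size K₁
          Z₁≤K₁ = ℕ.≤-pred (ℕ.≤-trans (tarsi critM) (ℕ.≤-reflexive (size-remove i₀∈M)))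
          varsK₁ : Vars K₁ V Z₁
          varsK₁ = record
            { within = λ l∈ → within varsK (Z₁⊆Z l∈)
            -- A variable of `Z₁` occurs in `M` in both signs, and `i₀` lacks one of them, so an
            -- occurrence survives the removal of `i₀`.
            ; met = λ {l′} l∈ →
                let b , l∉ = missing-sign (A⊆F i₀∈A) (within varsK (Z₁⊆Z l∈))
                    k , k∈M , l∈E = literal-occurs critM l∈ b
                in k , b , x∈p∧x≢y⇒x∈p-y k∈M (λ k≡i₀ → l∉ (subst (λ i → l′ ∈ E i b) k≡i₀ l∈E)) , l∈E
            ; meets = λ k∈ l∈V l∈E →
                coversM (proj₁ (x∈p-y⁻ M k∈)) (meets varsK (K₁⊆K k∈) l∈V l∈E) l∈E
            }
          by-size : Dec (size K₁ < size K) → j ∈ Z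
          by-size (yes K₁<K) = Z₁⊆Z (spans k (λ k∈ → K⊆F (K₁⊆K k∈)) varsK₁ (l , coversM i₀∈M l∈Z l∈E)
            i∈F (λ i∈ → i∉K (K₁⊆K i∈)) Z₁≤K₁ (ℕ.<-≤-trans K₁<K (ℕ.≤-pred K<k)) j∈V)
          by-size (no K₁≮K) =
            let u , u∈Z₁ , once = once-in-each-sign _ critM M≡1+Z₁ (l , coversM i₀∈M l∈Z l∈E) ℕ.≤-refl
            in contradiction (atMostOnce-⊆ (into-M u∈Z₁) (once (φ u))) (nonsing (within varsK (Z₁⊆Z u∈Z₁)) (φ u))
            where
            K⊆K₁ : K ⊆ K₁
            K⊆K₁ {k} k∈K = decidable-stable (k ∈? K₁) λ k∉ → K₁≮K (p⊂q⇒∣p∣<∣q∣ (K₁⊆K , k , k∈K , k∉))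
            Z⊆Z₁ : Z ⊆ Z₁
            Z⊆Z₁ l∈Z = let k , c , k∈K , l∈E = met varsK l∈Z in
              coversM (proj₁ (x∈p-y⁻ M (K⊆K₁ k∈K))) l∈Z l∈E
            M≡1+Z₁ : size M ≡ suc (size Z₁)
            M≡1+Z₁ = begin-equality
              size M           ≡⟨ size-remove i₀∈M ⟩
              suc (size K₁)    ≡⟨ cong (suc ∘ size) (⊆-antisym K₁⊆K K⊆K₁) ⟩
              suc (size K)     ≡⟨ cong suc K≡Z ⟩
              suc (size Z)     ≡⟨ cong (suc ∘ size) (⊆-antisym Z⊆Z₁ Z₁⊆Z) ⟩
              suc (size Z₁)    ∎
            in-K : ∀ {u k} → u ∈ Z₁ → u ∈ E k (φ u) → k ∈ K ⊎ k ∈ A → k ∈ K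
            in-K _ _ (inj₁ k∈K) = k∈K
            in-K {u} {k} u∈Z₁ u∈E (inj₂ k∈A) = contradiction
              (λ k′ k′∈ → [ φ⊨K k′
                          , (λ k′∈k → subst (Sat φ Z) (sym (x∈⁅y⁆⇒x≡y k k′∈k)) (u , Z₁⊆Z u∈Z₁ , u∈E))
                          ]′ (x∈p∪q⁻ K ⁅ k ⁆ k′∈))
              (unsat-with F⊆ k∈A φ)
            into-M : ∀ {u k} → u ∈ Z₁ → k ∈ F → u ∈ E k (φ u) → k ∈ M
            into-M u∈Z₁ k∈F u∈E = proj₁ (x∈p-y⁻ M (K⊆K₁ (in-K u∈Z₁ u∈E (x∈p∪q⁻ K A (F⊆ k∈F)))))

        by-cases : (∃[ i ] i ∈ F × i ∉ K ∪ A) ⊎ F ⊆ K ∪ A → j ∈ Z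
        by-cases (inj₁ (r , r∈F , r∉)) = one-left r∈F r∉
        by-cases (inj₂ F⊆) = all-left F⊆

      -- The clauses of F that avoid a literal contain a subset K of nonnegative deficiency, which
      -- therefore uses all variables and misses at most two clauses.
      at-most-twice : ∀ {v b i₁ i₂ i₃} → v ∈ V → i₁ ∈ F → i₂ ∈ F → i₃ ∈ F →
        v ∈ E i₁ b → v ∈ E i₂ b → v ∈ E i₃ b → i₁ ≢ i₂ → i₁ ≢ i₃ → i₂ ≡ i₃
      at-most-twice {v} {b} {i₁} {i₂} {i₃} v∈V i₁∈F i₂∈F i₃∈F v∈₁ v∈₂ v∈₃ i₁≢i₂ i₁≢i₃ =
        decidable-stable (i₂ ≟ i₃) λ i₂≢i₃ → ℕ.<-irrefl refl (begin-strict
          size F                           ≡⟨ F≡2+V ⟩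
          2 + size V                       ≤⟨ ℕ.+-monoʳ-≤ 2 (p⊆q⇒∣p∣≤∣q∣ V⊆Z) ⟩
          2 + size Z                       ≤⟨ ℕ.+-monoʳ-≤ 2 (splitting-Z≤K s) ⟩
          2 + size K                       ≤⟨ ℕ.+-monoʳ-≤ 2 (p⊆q⇒∣p∣≤∣q∣ K⊆) ⟩
          2 + size (F - i₁ - i₂ - i₃)      <⟨ ℕ.n<1+n _ ⟩
          3 + size (F - i₁ - i₂ - i₃)      ≡⟨ cong (2 +_) (size-remove (x∈p∧x≢y⇒x∈p-y
                                                (x∈p∧x≢y⇒x∈p-y i₃∈F (≢-sym i₁≢i₃)) (≢-sym i₂≢i₃))) ⟨
          2 + size (F - i₁ - i₂)           ≡⟨ cong suc (size-remove (x∈p∧x≢y⇒x∈p-y i₂∈F (≢-sym i₁≢i₂))) ⟨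
          1 + size (F - i₁)                ≡⟨ size-remove i₁∈F ⟨
          size F                           ∎)
        where
        open ℕ.≤-Reasoning
        s : Splitting F V v b
        s = split crit v∈V b
        open Splitting s
        avoid : ∀ {k i} → k ∈ K → v ∈ E i b → k ≢ i
        avoid k∈K v∈E refl = avoids k∈K v∈E
        V⊆Z : V ⊆ Z
        V⊆Z = spans _ K⊆F vars (v , v∈Z) i₁∈F (λ i₁∈K → avoids i₁∈K v∈₁) (splitting-Z≤K s) ℕ.≤-refl
        K⊆ : K ⊆ F - i₁ - i₂ - i₃
        K⊆ k∈K = x∈p∧x≢y⇒x∈p-y (x∈p∧x≢y⇒x∈p-y (x∈p∧x≢y⇒x∈p-y (K⊆F k∈K) (avoid k∈K v∈₁)) (avoid k∈K v∈₂)) (avoid k∈K v∈₃)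

-- Singular DP-reduction and its confluence

record State (m n : ℕ) : Set where
  field
    rows : Subset m
    cols : Subset n
    E    : Fin m → Bool → Subset n

  open Rows E public hiding (unsat; minimal; occurs; not-sat)
  open Counting E public using (AtMostOnce)
  open Deficiency2 E public

module _ {m n : ℕ} where

  open State
  open Rows using (unsat; minimal; occurs; not-sat)

  record MU₂ (S : State m n) : Set where
    field
      critical   : Critical S (rows S) (cols S)
      clash-free : ClashFree S (rows S) (cols S)
      deficiency : size (rows S) ≡ 2 + size (cols S)

    no-clash : ∀ {i j c d} → i ∈ rows S → j ∈ cols S → j ∈ E S i c → j ∈ E S i d → c ≡ d
    no-clash {c = false} {false} _ _ _ _ = refl
    no-clash {c = false} {true} i∈ j∈ p q = contradiction q (clash-free i∈ j∈ p)
    no-clash {c = true} {false} i∈ j∈ p q = contradiction q (clash-free i∈ j∈ p)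
    no-clash {c = true} {true} _ _ _ _ = refl

  open MU₂ public

  record Pivot (S : State m n) (v : Fin n) (b : Bool) (i : Fin m) : Set where
    field
      v∈cols : v ∈ cols S
      i∈rows : i ∈ rows S
      v∈Ei   : v ∈ E S i b
      unique : ∀ k → k ∈ rows S → v ∈ E S k b → k ≡ i

  open Pivot public

  Irreducible : State m n → Set
  Irreducible S = ∀ v b i → ¬ Pivot S v b i

  -- Rows keep their indices: a side clause k becomes k ∪ i in place, and v is only dropped from cols.
  eliminate : State m n → Fin n → Bool → Fin m → State m n
  eliminate S v b i = record
    { rows = rows S - i
    ; cols = cols S - v
    ; E    = λ k c → if does (v ∈? E S k (not b)) then E S k c ∪ E S i c else E S k c
    }

  eliminate-old : ∀ S v b i {k c j} → j ∈ E S k c → j ∈ E (eliminate S v b i) k c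
  eliminate-old S v b i {k} j∈ with v ∈? E S k (not b)
  ... | yes _ = x∈p∪q⁺ (inj₁ j∈)
  ... | no _ = j∈

  eliminate-new : ∀ S v b i {k c j} → v ∈ E S k (not b) → j ∈ E S i c → j ∈ E (eliminate S v b i) k c
  eliminate-new S v b i {k} v∈ j∈ with v ∈? E S k (not b)
  ... | yes _ = x∈p∪q⁺ (inj₂ j∈)
  ... | no v∉ = contradiction v∈ v∉

  eliminate⁻ : ∀ S v b i {k c j} → j ∈ E (eliminate S v b i) k c →
    j ∈ E S k c ⊎ (v ∈ E S k (not b) × j ∈ E S i c)
  eliminate⁻ S v b i {k} {c} j∈ with v ∈? E S k (not b)
  ... | no _ = inj₁ j∈
  ... | yes v∈ with x∈p∪q⁻ (E S k c) (E S i c) j∈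
  ...   | inj₁ p = inj₁ p
  ...   | inj₂ q = inj₂ (v∈ , q)

  module _ {S : State m n} (mu : MU₂ S) {v b i} (p : Pivot S v b i) where

    pivot-≢ : ∀ {k} → v ∈ E S k (not b) → k ≢ i
    pivot-≢ v∈ refl = clash-free mu (i∈rows p) (v∈cols p) (v∈Ei p) v∈

    private
      side : ∃[ k ] k ∈ rows S × v ∈ E S k (not b)
      side = literal-occurs S (critical mu) (v∈cols p) (not b)

    -- An assignment falsifying only the clause k, which contains the complement of the singular
    -- literal, also falsifies the rest of the main clause i: otherwise it could be flipped at v.
    falsifies-main : ∀ {k φ} → k ∈ rows S → v ∈ E S k (not b) →
      FalsifiesOnly S φ (rows S) (cols S) k → ∀ {j} → j ∈ cols S → j ≢ v → j ∉ E S i (φ j)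
    falsifies-main {k} {φ} k∈ v∈k only {j} j∈cols j≢v j∈Ei = unsat (critical mu) (φ [ v ≔ not b ]) model
      where
      at-v : ∀ {l} → v ∈ E S l (not b) → Sat S (φ [ v ≔ not b ]) (cols S) l
      at-v {l} v∈l = v , v∈cols p , subst (λ c → v ∈ E S l c) (sym (updateAt-updates v φ)) v∈l
      elsewhere : ∀ {l j} → j ∈ cols S → j ≢ v → j ∈ E S l (φ j) → Sat S (φ [ v ≔ not b ]) (cols S) l
      elsewhere {l} {j} j∈ j≢v j∈l = j , j∈ , subst (λ c → j ∈ E S l c) (sym (updateAt-minimal j v φ j≢v)) j∈l
      model : Models S (φ [ v ≔ not b ]) (rows S) (cols S)
      model l l∈ with l ≟ i | l ≟ k
      ... | yes refl | _ = elsewhere j∈cols j≢v j∈Ei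
      ... | no _ | yes refl = at-v v∈k
      ... | no l≢i | no l≢k with j , j∈ , j∈l ← only l l∈ l≢k with j ≟ v
      ...   | no j≢v = elsewhere j∈ j≢v j∈l
      ...   | yes refl = at-v (subst (λ c → v ∈ E S l c) (not-≢ λ φv≡b →
                l≢i (unique p l l∈ (subst (λ c → v ∈ E S l c) φv≡b j∈l))) j∈l)

    -- One assignment falsifies the side clause `k` and, by `falsifies-main`, the rest of `i`; both
    -- signs are opposite to its value at `j`. This is what makes `i` and `k` resolvable exactly at
    -- `v`.
    clash-only-at-pivot : ∀ {k j c d} → k ∈ rows S → v ∈ E S k (not b) → j ∈ cols S → j ≢ v →
      j ∈ E S i c → j ∈ E S k d → c ≡ d
    clash-only-at-pivot {k} {j} {c} {d} k∈ v∈k j∈cols j≢v j∈Ei j∈Ek with φ , only ← minimal (critical mu) k∈ =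
      trans (not-≢ {c} {φ j} λ { refl → falsifies-main k∈ v∈k only j∈cols j≢v j∈Ei })
        (sym (not-≢ {d} {φ j} λ { refl → not-sat (critical mu) only (j , j∈cols , j∈Ek) }))

    private
      S′ : State m n
      S′ = eliminate S v b i

    -- A model of the reduct would extend to `S` by a choice at `v`. If it makes the rest of `i`
    -- true, `not b` takes care of all side clauses. If not, `b` satisfies `i`, and the literals
    -- copied from `i` are false, so the side clauses hold without them.
    eliminate-unsat : Unsat S′ (rows S′) (cols S′)
    eliminate-unsat φ φ⊨ with any? (λ j → (j ∈? cols S - v) ×-dec (j ∈? E S i (φ j)))
    ... | yes (j , j∈ , j∈Ei) = unsat (critical mu) (φ [ v ≔ not b ]) model
      where
      elsewhere : ∀ {l j} → j ∈ cols S - v → j ∈ E S l (φ j) → Sat S (φ [ v ≔ not b ]) (cols S) l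
      elsewhere {l} {j} j∈ j∈l with j∈cols , j≢v ← x∈p-y⁻ (cols S) j∈ =
        j , j∈cols , subst (λ c → j ∈ E S l c) (sym (updateAt-minimal j v φ j≢v)) j∈l
      model : Models S (φ [ v ≔ not b ]) (rows S) (cols S)
      model l l∈ with l ≟ i
      ... | yes refl = elsewhere j∈ j∈Ei
      ... | no l≢i with l′ , l′∈ , l′∈E ← φ⊨ l (x∈p∧x≢y⇒x∈p-y l∈ l≢i) with eliminate⁻ S v b i l′∈E
      ...   | inj₁ old = elsewhere l′∈ old
      ...   | inj₂ (v∈l , _) = v , v∈cols p , subst (λ c → v ∈ E S l c) (sym (updateAt-updates v φ)) v∈l
    ... | no none = unsat (critical mu) (φ [ v ≔ b ]) model
      where
      model : Models S (φ [ v ≔ b ]) (rows S) (cols S)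
      model l l∈ with l ≟ i
      ... | yes refl = v , v∈cols p , subst (λ c → v ∈ E S l c) (sym (updateAt-updates v φ)) (v∈Ei p)
      ... | no l≢i with j , j∈ , j∈E ← φ⊨ l (x∈p∧x≢y⇒x∈p-y l∈ l≢i) with eliminate⁻ S v b i j∈E
      ...   | inj₂ (_ , j∈Ei) = contradiction (j , j∈ , j∈Ei) none
      ...   | inj₁ old with j∈cols , j≢v ← x∈p-y⁻ (cols S) j∈ =
        j , j∈cols , subst (λ c → j ∈ E S l c) (sym (updateAt-minimal j v φ j≢v)) old

    eliminate-minimal : ∀ {k} → k ∈ rows S′ → ∃[ φ ] FalsifiesOnly S′ φ (rows S′) (cols S′) k
    eliminate-minimal {k} k∈ with k∈rows , k≢i ← x∈p-y⁻ (rows S) k∈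
                          with φ , only ← minimal (critical mu) k∈rows = φ , other
      where
      other : FalsifiesOnly S′ φ (rows S′) (cols S′) k
      other l l∈ l≢k with l∈rows , l≢i ← x∈p-y⁻ (rows S) l∈
                     with j , j∈ , j∈l ← only l l∈rows l≢k with j ≟ v
      ... | no j≢v = j , x∈p∧x≢y⇒x∈p-y j∈ j≢v , eliminate-old S v b i j∈l
      -- Here `l` is satisfied at `v`, hence is a side clause and has received the rest of `i`. Now
      -- `φ` satisfies `i` too, and not at `v`, where its value is `not b`.
      ... | yes refl with j′ , j′∈ , j′∈i ← only i (i∈rows p) (≢-sym k≢i) =
        j′ , x∈p∧x≢y⇒x∈p-y j′∈ (λ { refl → clash-free mu (i∈rows p) j′∈ (v∈Ei p)
                                    (subst (λ c → v ∈ E S i c) φv≡¬b j′∈i) }) ,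
        eliminate-new S v b i (subst (λ c → v ∈ E S l c) φv≡¬b j∈l) j′∈i
        where
        φv≡¬b : φ v ≡ not b
        φv≡¬b = not-≢ λ φv≡b → l≢i (unique p l l∈rows (subst (λ c → v ∈ E S l c) φv≡b j∈l))

    eliminate-occurs : ∀ {j} → j ∈ cols S′ → Occurs S′ (rows S′) j
    eliminate-occurs j∈ with j∈cols , _ ← x∈p-y⁻ (cols S) j∈
                     with k , c , k∈ , j∈k ← occurs (critical mu) j∈cols with k ≟ i
    ... | no k≢i = k , c , x∈p∧x≢y⇒x∈p-y k∈ k≢i , eliminate-old S v b i j∈k
    ... | yes refl with k , k∈ , v∈k ← side =
      k , c , x∈p∧x≢y⇒x∈p-y k∈ (pivot-≢ v∈k) , eliminate-new S v b i v∈k j∈k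

    eliminate-MU₂ : MU₂ S′
    eliminate-MU₂ = record
      { critical = record { unsat = eliminate-unsat ; minimal = eliminate-minimal ; occurs = eliminate-occurs }
      ; clash-free = λ {k} k∈ j∈ p q → not-¬ refl (no-clash′ k∈ j∈ p q)
      ; deficiency = ℕ.suc-injective (trans (sym (size-remove (i∈rows p)))
                       (trans (deficiency mu) (cong (2 +_) (size-remove (v∈cols p)))))
      }
      where
      no-clash′ : ∀ {k j c d} → k ∈ rows S′ → j ∈ cols S′ → j ∈ E S′ k c → j ∈ E S′ k d → c ≡ d
      no-clash′ k∈ j∈ x y with k∈rows , k≢i ← x∈p-y⁻ (rows S) k∈ | j∈cols , j≢v ← x∈p-y⁻ (cols S) j∈
                           with eliminate⁻ S v b i x | eliminate⁻ S v b i y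
      ... | inj₁ x′ | inj₁ y′ = no-clash mu k∈rows j∈cols x′ y′
      ... | inj₁ x′ | inj₂ (v∈k , y′) = sym (clash-only-at-pivot k∈rows v∈k j∈cols j≢v y′ x′)
      ... | inj₂ (v∈k , x′) | inj₁ y′ = clash-only-at-pivot k∈rows v∈k j∈cols j≢v x′ y′
      ... | inj₂ (_ , x′) | inj₂ (_ , y′) = no-clash mu (i∈rows p) j∈cols x′ y′

    size-eliminate : size (cols S′) < size (cols S)
    size-eliminate = x∈p⇒∣p-x∣<∣p∣ (v∈cols p)

-- Equality and isomorphism of states, reduction sequences

module _ {m n : ℕ} where

  open State
  open Rows using (minimal; not-sat)

  open ClauseSets {V = Fin n} _≟_ using (Literal; complement; LiteralBijection; complement-involutive)
  open LiteralBijection using (bijection; to; from; commutes; strictlyInverseʳ)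

  Has : State m n → Fin m → Literal → Set
  Has S k x = proj₁ x ∈ cols S × proj₁ x ∈ E S k (proj₂ x)

  Match : (Literal → Literal) → State m n → Fin m → State m n → Fin m → Set
  Match f S k T l = ∀ x → (Has S k x → Has T l (f x)) × (Has T l (f x) → Has S k x)

  record Matches (f : Literal → Literal) (S T : State m n) : Set where
    field
      forth : ∀ {k} → k ∈ rows S → ∃[ l ] l ∈ rows T × Match f S k T l
      back  : ∀ {l} → l ∈ rows T → ∃[ k ] k ∈ rows S × Match f S k T l

  open Matches public

  infix 4 _≋_ _≃_

  _≋_ : State m n → State m n → Set
  _≋_ = Matches id

  _≃_ : State m n → State m n → Set
  S ≃ T = ∃[ α ] Matches (to α) S T

  ≋-refl : ∀ {S} → S ≋ S
  ≋-refl = record { forth = λ k∈ → _ , k∈ , λ x → id , id ; back = λ k∈ → _ , k∈ , λ x → id , id }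

  ≋-sym : ∀ {S T} → S ≋ T → T ≋ S
  ≋-sym eq = record
    { forth = λ k∈ → let l , l∈ , mt = back eq k∈ in l , l∈ , λ x → proj₂ (mt x) , proj₁ (mt x)
    ; back  = λ k∈ → let l , l∈ , mt = forth eq k∈ in l , l∈ , λ x → proj₂ (mt x) , proj₁ (mt x)
    }

  ≋⇒≃ : ∀ {S T} → S ≋ T → S ≃ T
  ≋⇒≃ eq = record { bijection = ↔-id Literal ; commutes = λ x → refl } , eq

  ≃-trans : ∀ {S T U} → S ≃ T → T ≃ U → S ≃ U
  ≃-trans (α , eq₁) (β , eq₂) =
    record { bijection = bijection β ↔-∘ bijection α
           ; commutes = λ x → trans (cong (to β) (commutes α x)) (commutes β (to α x)) } ,
    record
      { forth = λ k∈ → let l , l∈ , mt = forth eq₁ k∈ ; u , u∈ , mt′ = forth eq₂ l∈ in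
          u , u∈ , λ x → (λ h → proj₁ (mt′ _) (proj₁ (mt x) h)) , (λ h → proj₂ (mt x) (proj₂ (mt′ _) h))
      ; back = λ u∈ → let l , l∈ , mt′ = back eq₂ u∈ ; k , k∈ , mt = back eq₁ l∈ in
          k , k∈ , λ x → (λ h → proj₁ (mt′ _) (proj₁ (mt x) h)) , (λ h → proj₂ (mt x) (proj₂ (mt′ _) h))
      }

  ≃-sym : ∀ {S T} → S ≃ T → T ≃ S
  ≃-sym {S} {T} (α , eq) = record { bijection = ↔-sym (bijection α) ; commutes = commutes′ } , record
    { forth = λ k∈ → let l , l∈ , mt = back eq k∈ in l , l∈ , flip mt
    ; back = λ k∈ → let l , l∈ , mt = forth eq k∈ in l , l∈ , flip mt
    }
    where
    to-from : ∀ y → to α (from α y) ≡ y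
    to-from = Inverse.strictlyInverseˡ (bijection α)
    commutes′ : ∀ x → from α (complement x) ≡ complement (from α x)
    commutes′ x = trans (cong (from α ∘ complement) (sym (to-from x)))
      (trans (cong (from α) (sym (commutes α (from α x)))) (strictlyInverseʳ α _))
    flip : ∀ {k l} → Match (to α) S k T l → Match (from α) T l S k
    flip {k} {l} mt y =
      (λ h → proj₂ (mt (from α y)) (subst (Has T l) (sym (to-from y)) h)) ,
      (λ h → subst (Has T l) (to-from y) (proj₁ (mt (from α y)) h))

  Contains : State m n → Fin m → State m n → Fin m → Set
  Contains T l S k = ∀ x → Has S k x → Has T l x

  -- The assignment falsifying only `l` would satisfy `k` by a literal that `l` also contains. This
  -- recovers row indices from contents, which is all that `_≋_` sees.
  distinct : ∀ {S} → MU₂ S → ∀ {k l} → k ∈ rows S → l ∈ rows S → Contains S l S k → k ≡ l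
  distinct {S} mu {k} {l} k∈ l∈ l⊇k with φ , only ← minimal (critical mu) l∈ =
    decidable-stable (k ≟ l) λ k≢l →
      let j , j∈ , j∈k = only k k∈ k≢l ; j∈′ , j∈l = l⊇k (j , φ j) (j∈ , j∈k)
      in not-sat (critical mu) only (j , j∈′ , j∈l)

  eliminate-contains : ∀ {S T v b i k l o} → v ∈ cols S → Contains T l S k → Contains T o S i →
    Contains (eliminate T v b o) l (eliminate S v b i) k
  eliminate-contains {S} {T} {v} {b} {i} {k} {l} {o} v∈ l⊇k o⊇i (j , c) (j∈ , j∈k)
    with j∈cols , j≢v ← x∈p-y⁻ (cols S) j∈
    with eliminate⁻ S v b i j∈k
  ... | inj₁ old = let j∈′ , j∈l = l⊇k (j , c) (j∈cols , old) in
    x∈p∧x≢y⇒x∈p-y j∈′ j≢v , eliminate-old T v b o j∈l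
  ... | inj₂ (v∈k , j∈i) = let j∈′ , j∈o = o⊇i (j , c) (j∈cols , j∈i) in
    x∈p∧x≢y⇒x∈p-y j∈′ j≢v , eliminate-new T v b o (proj₂ (l⊇k (v , not b) (v∈ , v∈k))) j∈o

  pivot-≋ : ∀ {S T v b i} → MU₂ S → MU₂ T → S ≋ T → Pivot S v b i →
    ∃[ l ] Pivot T v b l × eliminate S v b i ≋ eliminate T v b l
  pivot-≋ {S} {T} {v} {b} {i} muS muT eq p with l , l∈ , mt ← forth eq (i∈rows p) =
    l , pivotT , record { forth = forth′ ; back = back′ }
    where
    pivotT : Pivot T v b l
    pivotT = record
      { v∈cols = proj₁ (proj₁ (mt (v , b)) (v∈cols p , v∈Ei p))
      ; i∈rows = l∈
      ; v∈Ei = proj₂ (proj₁ (mt (v , b)) (v∈cols p , v∈Ei p))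
      ; unique = λ k′ k′∈ v∈k′ →
          let k , k∈ , mt′ = back eq k′∈
              v∈T = proj₁ (proj₁ (mt (v , b)) (v∈cols p , v∈Ei p))
              k≡i = unique p k k∈ (proj₂ (proj₂ (mt′ (v , b)) (v∈T , v∈k′)))
          in distinct muT k′∈ l∈ λ x h → proj₁ (mt x) (subst (λ k → Has S k x) k≡i (proj₂ (mt′ x) h))
      }
    reduced : ∀ {k k′} → Match id S k T k′ → Match id (eliminate S v b i) k (eliminate T v b l) k′
    reduced mt′ x =
      eliminate-contains {S} {T} (v∈cols p) (λ x → proj₁ (mt′ x)) (λ x → proj₁ (mt x)) x ,
      eliminate-contains {T} {S} (v∈cols pivotT) (λ x → proj₂ (mt′ x)) (λ x → proj₂ (mt x)) x
    forth′ : ∀ {k} → k ∈ rows S - i → ∃[ k′ ] k′ ∈ rows T - l × Match id (eliminate S v b i) k (eliminate T v b l) k′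
    forth′ k∈ = let k∈S , k≢i = x∈p-y⁻ (rows S) k∈ ; k′ , k′∈ , mt′ = forth eq k∈S in
      k′ , x∈p∧x≢y⇒x∈p-y k′∈ (λ k′≡l → k≢i (distinct muS k∈S (i∈rows p)
             λ x h → proj₂ (mt x) (subst (λ k → Has T k x) k′≡l (proj₁ (mt′ x) h)))) , reduced mt′
    back′ : ∀ {k′} → k′ ∈ rows T - l → ∃[ k ] k ∈ rows S - i × Match id (eliminate S v b i) k (eliminate T v b l) k′
    back′ k′∈ = let k′∈T , k′≢l = x∈p-y⁻ (rows T) k′∈ ; k , k∈ , mt′ = back eq k′∈T in
      k , x∈p∧x≢y⇒x∈p-y k∈ (λ k≡i → k′≢l (distinct muT k′∈T l∈
             λ x h → proj₁ (mt x) (subst (λ k → Has S k x) k≡i (proj₂ (mt′ x) h)))) , reduced mt′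

  pivot? : ∀ (S : State m n) → Dec (∃[ v ] ∃[ b ] ∃[ i ] Pivot S v b i)
  pivot? S = any? λ v → map′
    (λ { (inj₁ p) → true , p ; (inj₂ p) → false , p })
    (λ { (true , p) → inj₁ p ; (false , p) → inj₂ p })
    (any? (pivot-at? v true) ⊎-dec any? (pivot-at? v false))
    where
    pivot-at? : ∀ v b i → Dec (Pivot S v b i)
    pivot-at? v b i = map′
      (λ (v∈ , i∈ , v∈i , un) → record { v∈cols = v∈ ; i∈rows = i∈ ; v∈Ei = v∈i ; unique = un })
      (λ p → v∈cols p , i∈rows p , v∈Ei p , unique p)
      ((v ∈? cols S) ×-dec ((i ∈? rows S) ×-dec ((v ∈? E S i b) ×-dec
        all? λ k → (k ∈? rows S) →-dec ((v ∈? E S k b) →-dec (k ≟ i)))))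

  data Reach : State m n → State m n → Set where
    done : ∀ {S} → Irreducible S → Reach S S
    step : ∀ {S T v b i} → Pivot S v b i → Reach (eliminate S v b i) T → Reach S T

  reach : ∀ d {S} → MU₂ S → size (cols S) < d → ∃[ T ] Reach S T
  reach (suc d) {S} mu S<d with pivot? S
  ... | no none = S , done λ v b i p → none (v , b , i , p)
  ... | yes (_ , _ , _ , p) =
    let T , r = reach d (eliminate-MU₂ mu p) (ℕ.<-≤-trans (size-eliminate mu p) (ℕ.≤-pred S<d)) in T , step p r

  reach-≋ : ∀ {S S′ T} → MU₂ S → MU₂ S′ → S ≋ S′ → Reach S T → ∃[ T′ ] Reach S′ T′ × T ≋ T′
  reach-≋ {S} {S′} mu mu′ eq (done irr) = S′ ,
    done (λ v b i p → let l , q , _ = pivot-≋ mu′ mu (≋-sym eq) p in irr v b l q) , eq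
  reach-≋ mu mu′ eq (step p r)
    with l , q , eq′ ← pivot-≋ mu mu′ eq p
    with T′ , r′ , eq″ ← reach-≋ (eliminate-MU₂ mu p) (eliminate-MU₂ mu′ q) eq′ r = T′ , step q r′ , eq″

  module _ {S : State m n} (mu : MU₂ S) where

    -- Each sign of `v` occurs once, in `i` and in `d`. Both reductions form the union of these two
    -- clauses, stored at index `d` in one case and at `i` in the other.
    flip-pivot : ∀ {v b c i d} → b ≡ not c → c ≡ not b → Pivot S v b i → Pivot S v c d →
      eliminate S v b i ≋ eliminate S v c d
    flip-pivot {v} b≡¬c c≡¬b p q = record
      { forth = λ k∈ → forward b≡¬c c≡¬b p q k∈
      ; back = λ k∈ → let l , l∈ , mt = forward c≡¬b b≡¬c q p k∈ in l , l∈ , λ x → proj₂ (mt x) , proj₁ (mt x)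
      }
      where
      contains : ∀ {b c i d k l} → c ≡ not b → b ≡ not c → Pivot S v b i → Pivot S v c d →
        (k ≡ d × l ≡ i) ⊎ (k ≡ l × k ≢ d) → k ∈ rows S → Contains (eliminate S v c d) l (eliminate S v b i) k
      contains {b} {c} {i} {d} refl b≡¬c p q (inj₁ (refl , refl)) _ (j , e) (j∈ , j∈k) with eliminate⁻ S v b i j∈k
      ... | inj₁ j∈d = j∈ , eliminate-new S v c d (subst (λ a → v ∈ E S i a) b≡¬c (v∈Ei p)) j∈d
      ... | inj₂ (_ , j∈i) = j∈ , eliminate-old S v c d j∈i
      contains {b} {c} {i} {d} {k} refl b≡¬c p q (inj₂ (refl , k≢d)) k∈ (j , e) (j∈ , j∈k) with eliminate⁻ S v b i j∈k
      ... | inj₁ old = j∈ , eliminate-old S v c d old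
      ... | inj₂ (v∈k , _) = contradiction (unique q k k∈ v∈k) k≢d
      forward : ∀ {b c i d k} → b ≡ not c → c ≡ not b → Pivot S v b i → Pivot S v c d → k ∈ rows S - i →
        ∃[ l ] l ∈ rows S - d × Match id (eliminate S v b i) k (eliminate S v c d) l
      forward {i = i} {d} {k} b≡¬c c≡¬b p q k∈ with k ≟ d
      ... | yes refl = i ,
        x∈p∧x≢y⇒x∈p-y (i∈rows p) (≢-sym (proj₂ (x∈p-y⁻ (rows S) k∈))) ,
        λ x → contains c≡¬b b≡¬c p q (inj₁ (refl , refl)) (i∈rows q) x ,
              contains b≡¬c c≡¬b q p (inj₁ (refl , refl)) (i∈rows p) x
      ... | no k≢d with k∈S , k≢i ← x∈p-y⁻ (rows S) k∈ = k , x∈p∧x≢y⇒x∈p-y k∈S k≢d ,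
        λ x → contains c≡¬b b≡¬c p q (inj₂ (refl , k≢d)) k∈S x ,
              contains b≡¬c c≡¬b q p (inj₂ (refl , k≢i)) k∈S x

    -- The literal `(w , c)` lies only in `j`, hence not in `i`, so copying `i` into the side
    -- clauses of `v` creates no new occurrence.
    pivot-after : ∀ {v b i w c j} → Pivot S v b i → Pivot S w c j → v ≢ w → i ≢ j → Pivot (eliminate S v b i) w c j
    pivot-after {v} {b} {i} p q v≢w i≢j = record
      { v∈cols = x∈p∧x≢y⇒x∈p-y (v∈cols q) (≢-sym v≢w)
      ; i∈rows = x∈p∧x≢y⇒x∈p-y (i∈rows q) (≢-sym i≢j)
      ; v∈Ei = eliminate-old S v b i (v∈Ei q)
      ; unique = λ k k∈ w∈k → [ unique q k (proj₁ (x∈p-y⁻ (rows S) k∈))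
                              , (λ (_ , w∈i) → contradiction (unique q i (i∈rows p) w∈i) i≢j)
                              ]′ (eliminate⁻ S v b i w∈k)
      }

  -- A literal of row `k` after both steps was in `k` or was copied from `i` or `j`, directly or
  -- through the other of the two. Each route leads to row `k` in the opposite order as well.
  eliminate-comm : ∀ {S : State m n} {v b i w c j} →
    eliminate (eliminate S v b i) w c j ≋ eliminate (eliminate S w c j) v b i
  eliminate-comm {S} {v} {b} {i} {w} {c} {j} = record
    { forth = λ {k} k∈ → k , subst (k ∈_) (p─x─y≡p─y─x (rows S) i j) k∈ , λ x → contains x , contains x
    ; back = λ {k} k∈ → k , subst (k ∈_) (p─x─y≡p─y─x (rows S) j i) k∈ , λ x → contains x , contains x
    }
    where
    contains : ∀ {v b i w c j k} → Contains (eliminate (eliminate S w c j) v b i) k (eliminate (eliminate S v b i) w c j) k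
    contains {v} {b} {i} {w} {c} {j} {k} (y , e) (y∈ , y∈k) =
      subst (y ∈_) (p─x─y≡p─y─x (cols S) v w) y∈ , entry (eliminate⁻ (eliminate S v b i) w c j y∈k)
      where
      S₂ : State m n
      S₂ = eliminate S w c j
      entry : _ → y ∈ E (eliminate S₂ v b i) k e
      entry (inj₁ y∈k) with eliminate⁻ S v b i y∈k
      ... | inj₁ y∈k = eliminate-old S₂ v b i (eliminate-old S w c j y∈k)
      ... | inj₂ (v∈k , y∈i) = eliminate-new S₂ v b i (eliminate-old S w c j v∈k) (eliminate-old S w c j y∈i)
      entry (inj₂ (w∈k , y∈j)) with eliminate⁻ S v b i w∈k | eliminate⁻ S v b i y∈j
      ... | inj₁ w∈k | inj₁ y∈j = eliminate-old S₂ v b i (eliminate-new S w c j w∈k y∈j)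
      ... | inj₁ w∈k | inj₂ (v∈j , y∈i) = eliminate-new S₂ v b i (eliminate-new S w c j w∈k v∈j) (eliminate-old S w c j y∈i)
      ... | inj₂ (v∈k , w∈i) | inj₁ y∈j = eliminate-new S₂ v b i (eliminate-old S w c j v∈k) (eliminate-new S w c j w∈i y∈j)
      ... | inj₂ (v∈k , w∈i) | inj₂ (v∈j , y∈i) = eliminate-new S₂ v b i (eliminate-old S w c j v∈k) (eliminate-old S w c j y∈i)

-- Shared main clauses and confluence up to isomorphism

module _ {m n : ℕ} where

  open State
  open Rows using (unsat; minimal; occurs)

  open ClauseSets {V = Fin n} _≟_ using (Literal; complement; LiteralBijection; complement-involutive)

  irreducible⇒nonsingular : ∀ {S : State m n} → MU₂ S → Irreducible S → Nonsingular S (rows S) (cols S)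
  irreducible⇒nonsingular {S} mu irr {u} u∈ b once
    with i , i∈ , u∈i ← literal-occurs S (critical mu) u∈ b =
    irr u b i record { v∈cols = u∈ ; i∈rows = i∈ ; v∈Ei = u∈i
                     ; unique = λ k k∈ u∈k → once k i k∈ i∈ u∈k u∈i }

  -- If v and w are singular with the same main clause i and reducing v gives a nonsingular S₁, then
  -- adding the clause i also to the side clauses of w keeps S₁ minimally unsatisfiable of
  -- deficiency 2. There every literal occurs exactly twice, so nothing has been added.
  module SharedMain {S : State m n} (mu : MU₂ S) {v b w c i} (p : Pivot S v b i) (q : Pivot S w c i)
    (v≢w : v ≢ w) (irr : Irreducible (eliminate S v b i)) where

    S₁ : State m n
    S₁ = eliminate S v b i

    mu₁ : MU₂ S₁
    mu₁ = eliminate-MU₂ mu p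

    S₂ : State m n
    S₂ = record
      { rows = rows S₁ ; cols = cols S₁
      -- The copy omits `w`: `i` contains `(w , c)`, which would clash with `(w , not c)` in the
      -- side clauses.
      ; E = λ k d → if does (w ∈? E S k (not c)) then E S₁ k d ∪ (E S i d - w) else E S₁ k d
      }

    old : ∀ {k d j} → j ∈ E S₁ k d → j ∈ E S₂ k d
    old {k} j∈ with w ∈? E S k (not c)
    ... | yes _ = x∈p∪q⁺ (inj₁ j∈)
    ... | no _ = j∈

    new : ∀ {k d j} → w ∈ E S k (not c) → j ≢ w → j ∈ E S i d → j ∈ E S₂ k d
    new {k} w∈ j≢w j∈ with w ∈? E S k (not c)
    ... | yes _ = x∈p∪q⁺ (inj₂ (x∈p∧x≢y⇒x∈p-y j∈ j≢w))
    ... | no w∉ = contradiction w∈ w∉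

    S₂⁻ : ∀ {k d j} → j ∈ E S₂ k d → j ∈ E S₁ k d ⊎ (w ∈ E S k (not c) × j ≢ w × j ∈ E S i d)
    S₂⁻ {k} {d} j∈ with w ∈? E S k (not c)
    ... | no _ = inj₁ j∈
    ... | yes w∈ with x∈p∪q⁻ (E S₁ k d) (E S i d - w) j∈
    ...   | inj₁ x = inj₁ x
    ...   | inj₂ y = let y∈ , y≢ = x∈p-y⁻ (E S i d) y in inj₂ (w∈ , y≢ , y∈)

    sat-old : ∀ {φ k} → Sat S₁ φ (cols S₁) k → Sat S₂ φ (cols S₂) k
    sat-old (j , j∈ , j∈k) = j , j∈ , old j∈k

    -- If a model falsifies what `i` contains besides `v` and `w`, the copied literals are false and
    -- it is a model of `S₁`. Otherwise `ψ` satisfies `S`: `i` holds by that rest, the side clauses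
    -- hold at `v` or `w`, and the remaining rows are unchanged and contain neither variable.
    unsat₂ : Unsat S₂ (rows S₂) (cols S₂)
    unsat₂ φ φ⊨ with any? (λ j → (j ∈? cols S₁) ×-dec (¬? (j ≟ w) ×-dec (j ∈? E S i (φ j))))
    ... | no none = unsat (critical mu₁) φ λ k k∈ → let j , j∈ , j∈k = φ⊨ k k∈ in
      [ (λ j∈₁ → j , j∈ , j∈₁)
      , (λ (_ , j≢w , j∈i) → contradiction (j , j∈ , j≢w , j∈i) none) ]′ (S₂⁻ j∈k)
    ... | yes (j , j∈ , j≢w , j∈i) = unsat (critical mu) ψ model
      where
      ψ : Fin n → Bool
      ψ = φ [ v ≔ not b ] [ w ≔ not c ]
      elsewhere : ∀ {k j} → j ∈ cols S₁ → j ≢ w → j ∈ E S k (φ j) → Sat S ψ (cols S) k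
      elsewhere {k} {j} j∈ j≢w j∈k with j∈cols , j≢v ← x∈p-y⁻ (cols S) j∈ = j , j∈cols ,
        subst (λ d → j ∈ E S k d) (sym (trans (updateAt-minimal j w _ j≢w) (updateAt-minimal j v φ j≢v))) j∈k
      model : Models S ψ (rows S) (cols S)
      model k k∈ with k ≟ i | v ∈? E S k (not b) | w ∈? E S k (not c)
      ... | yes refl | _ | _ = elsewhere j∈ j≢w j∈i
      ... | no _ | yes v∈k | _ = v , v∈cols p , subst (λ d → v ∈ E S k d)
        (sym (trans (updateAt-minimal v w _ v≢w) (updateAt-updates v φ))) v∈k
      ... | no _ | no _ | yes w∈k = w , v∈cols q ,
        subst (λ d → w ∈ E S k d) (sym (updateAt-updates w (φ [ v ≔ not b ]))) w∈k
      ... | no k≢i | no v∉k | no w∉k with l , l∈ , l∈k ← φ⊨ k (x∈p∧x≢y⇒x∈p-y k∈ k≢i) with S₂⁻ l∈k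
      ...   | inj₂ (w∈k , _) = contradiction w∈k w∉k
      ...   | inj₁ l∈₁ with eliminate⁻ S v b i l∈₁
      ...     | inj₂ (v∈k , _) = contradiction v∈k v∉k
      ...     | inj₁ l∈S with l ≟ w
      ...       | no l≢w = elsewhere l∈ l≢w l∈S
      ...       | yes refl = contradiction (subst (λ d → w ∈ E S k d)
                    (not-≢ λ φw≡c → k≢i (unique q k k∈ (subst (λ d → w ∈ E S k d) φw≡c l∈S))) l∈S) w∉k

    critical₂ : Critical S₂ (rows S₂) (cols S₂)
    critical₂ = record
      { unsat = unsat₂
      ; minimal = λ k∈ → let φ , only = minimal (critical mu₁) k∈ in φ , λ l l∈ l≢k → sat-old (only l l∈ l≢k)
      ; occurs = λ j∈ → let k , d , k∈ , j∈k = occurs (critical mu₁) j∈ in k , d , k∈ , old j∈k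
      }

    clash-main : ∀ {k j d e} → k ∈ rows S → j ∈ cols S₁ → j ≢ w → w ∈ E S k (not c) →
      j ∈ E S i d → j ∈ E S₁ k e → d ≡ e
    clash-main k∈ j∈ j≢w w∈k j∈i j∈k with j∈cols , j≢v ← x∈p-y⁻ (cols S) j∈ with eliminate⁻ S v b i j∈k
    ... | inj₁ old = clash-only-at-pivot mu q k∈ w∈k j∈cols j≢w j∈i old
    ... | inj₂ (_ , new) = no-clash mu (i∈rows p) j∈cols j∈i new

    no-clash₂ : ∀ {k j d e} → k ∈ rows S₂ → j ∈ cols S₂ → j ∈ E S₂ k d → j ∈ E S₂ k e → d ≡ e
    no-clash₂ k∈ j∈ x y with k∈S , _ ← x∈p-y⁻ (rows S) k∈ | j∈S , _ ← x∈p-y⁻ (cols S) j∈ with S₂⁻ x | S₂⁻ y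
    ... | inj₁ x′ | inj₁ y′ = no-clash mu₁ k∈ j∈ x′ y′
    ... | inj₁ x′ | inj₂ (w∈k , j≢w , y′) = sym (clash-main k∈S j∈ j≢w w∈k y′ x′)
    ... | inj₂ (w∈k , j≢w , x′) | inj₁ y′ = clash-main k∈S j∈ j≢w w∈k x′ y′
    ... | inj₂ (_ , _ , x′) | inj₂ (_ , _ , y′) = no-clash mu (i∈rows p) j∈S x′ y′

    nonsingular₂ : Nonsingular S₂ (rows S₂) (cols S₂)
    nonsingular₂ u∈ d once = irreducible⇒nonsingular mu₁ irr u∈ d
      λ k l k∈ l∈ u∈k u∈l → once k l k∈ l∈ (old u∈k) (old u∈l)

    -- If `(j , d)` were missing from `k` in `S`, its occurrence in row `k` of `S₂` would come on
    -- top of at least two in `S₁`, against `at-most-twice`.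
    main⊆side : ∀ {k j d} → k ∈ rows S → w ∈ E S k (not c) → j ∈ cols S → j ≢ v → j ≢ w →
      j ∈ E S i d → j ∈ E S k d
    main⊆side {k} {j} {d} k∈ w∈k j∈ j≢v j≢w j∈i = decidable-stable (j ∈? E S k d) λ j∉k →
      irreducible⇒nonsingular mu₁ irr j∈₁ d λ k₁ k₂ k₁∈ k₂∈ j∈k₁ j∈k₂ →
        at-most-twice S₂ critical₂ (deficiency mu₁) nonsingular₂
          (λ k∈ j∈ x y → not-¬ refl (no-clash₂ k∈ j∈ x y))
          j∈₁ k∈₁ k₁∈ k₂∈ (new w∈k j≢w j∈i) (old j∈k₁) (old j∈k₂) (other j∉k j∈k₁) (other j∉k j∈k₂)
      where
      j∈₁ : j ∈ cols S₁
      j∈₁ = x∈p∧x≢y⇒x∈p-y j∈ j≢v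
      k∈₁ : k ∈ rows S₁
      k∈₁ = x∈p∧x≢y⇒x∈p-y k∈ (pivot-≢ mu q w∈k)
      other : ∀ {l} → j ∉ E S k d → j ∈ E S₁ l d → k ≢ l
      other j∉k j∈l refl with eliminate⁻ S v b i j∈l
      ... | inj₁ j∈k = j∉k j∈k
      -- Otherwise `k` is a side clause of both `v` and `w`, and clashes with `i` at `w` besides
      -- `v`.
      ... | inj₂ (v∈k , _) = not-¬ refl (clash-only-at-pivot mu p k∈ v∈k (v∈cols q) (≢-sym v≢w) (v∈Ei q) w∈k)

  -- Chosen to send `c` to `not b` and `not c` to `b`. Reducing `v` gives its side clauses `(w , c)`
  -- from `i`, where reducing `w` leaves them `(v , not b)`; the side clauses of `w` keep
  -- `(w , not c)` in the first case and receive `(v , b)` in the second.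
  twist : Bool → Bool → Bool → Bool
  twist b c d = not ((b xor c) xor d)

  twist-not : ∀ b c d → twist b c (not d) ≡ not (twist b c d)
  twist-not false false false = refl
  twist-not false false true = refl
  twist-not false true false = refl
  twist-not false true true = refl
  twist-not true false false = refl
  twist-not true false true = refl
  twist-not true true false = refl
  twist-not true true true = refl

  twist-involutive : ∀ b c d → twist b c (twist c b d) ≡ d
  twist-involutive false false false = refl
  twist-involutive false false true = refl
  twist-involutive false true false = refl
  twist-involutive false true true = refl
  twist-involutive true false false = refl
  twist-involutive true false true = refl
  twist-involutive true true false = refl
  twist-involutive true true true = refl

  twist-same : ∀ b c → twist b c c ≡ not b
  twist-same false false = refl
  twist-same false true = refl
  twist-same true false = refl
  twist-same true true = refl

  abstract

    -- For v ≢ w, exchanges (v , b) with (w , not c) and (v , not b) with (w , c).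
    exchange : Fin n → Bool → Fin n → Bool → Literal → Literal
    exchange v b w c (j , d) =
      if does (j ≟ w) then (v , twist b c d) else if does (j ≟ v) then (w , twist b c d) else (j , d)

    exchange-w : ∀ v b w c d → exchange v b w c (w , d) ≡ (v , twist b c d)
    exchange-w v b w c d rewrite dec-true (w ≟ w) refl = refl

    exchange-v : ∀ {v b w c} d → v ≢ w → exchange v b w c (v , d) ≡ (w , twist b c d)
    exchange-v {v} {w = w} d v≢w rewrite dec-false (v ≟ w) v≢w | dec-true (v ≟ v) refl = refl

    exchange-other : ∀ {v b w c j} d → j ≢ v → j ≢ w → exchange v b w c (j , d) ≡ (j , d)
    exchange-other {v} {w = w} {j = j} d j≢v j≢w rewrite dec-false (j ≟ w) j≢w | dec-false (j ≟ v) j≢v = refl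

    exchange-complement : ∀ {v b w c} x → exchange v b w c (complement x) ≡ complement (exchange v b w c x)
    exchange-complement {v} {b} {w} {c} (j , d) with j ≟ w | j ≟ v
    ... | yes _ | _ = cong (v ,_) (twist-not b c d)
    ... | no _ | yes _ = cong (w ,_) (twist-not b c d)
    ... | no _ | no _ = refl

  exchange-inverse : ∀ {v b w c} → v ≢ w → ∀ x → exchange v b w c (exchange w c v b x) ≡ x
  exchange-inverse {v} {b} {w} {c} v≢w (j , d) with j ≟ w
  ... | yes refl = trans (cong (exchange v b w c) (exchange-v d (≢-sym v≢w)))
    (trans (exchange-v (twist c b d) v≢w) (cong (w ,_) (twist-involutive b c d)))
  ... | no j≢w with j ≟ v
  ...   | yes refl = trans (cong (exchange v b w c) (exchange-w w c v b d))
    (trans (exchange-w v b w c (twist c b d)) (cong (v ,_) (twist-involutive b c d)))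
  ...   | no j≢v = trans (cong (exchange v b w c) (exchange-other d j≢w j≢v)) (exchange-other d j≢v j≢w)

  -- Every row is matched with itself: by `main⊆side`, the literals copied from `i` were already
  -- present except at `v` and `w`.
  shared-main-≃ : ∀ {S : State m n} → MU₂ S → ∀ {v b w c i} → Pivot S v b i → Pivot S w c i → v ≢ w →
    Irreducible (eliminate S v b i) → Irreducible (eliminate S w c i) → eliminate S v b i ≃ eliminate S w c i
  shared-main-≃ {S} mu {v} {b} {w} {c} {i} p q v≢w irr₁ irr₂ =
    record { bijection = mk↔ₛ′ (exchange v b w c) (exchange w c v b)
                           (exchange-inverse v≢w) (exchange-inverse (≢-sym v≢w))
           ; commutes = exchange-complement } ,
    record { forth = λ k∈ → _ , k∈ , match k∈ ; back = λ k∈ → _ , k∈ , match k∈ }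
    where
    forward : ∀ {v b w c} → Pivot S v b i → Pivot S w c i → v ≢ w → Irreducible (eliminate S w c i) →
      ∀ {k} → k ∈ rows S - i → ∀ x → Has (eliminate S v b i) k x → Has (eliminate S w c i) k (exchange v b w c x)
    forward {v} {b} {w} {c} p q v≢w irr {k} k∈ (j , d) (j∈ , j∈k)
      with k∈S , k≢i ← x∈p-y⁻ (rows S) k∈ | j∈S , j≢v ← x∈p-y⁻ (cols S) j∈ with j ≟ w
    ... | no j≢w = subst (Has (eliminate S w c i) k) (sym (exchange-other d j≢v j≢w))
      (x∈p∧x≢y⇒x∈p-y j∈S j≢w , eliminate-old S w c i
        ([ id , (λ (v∈k , j∈i) → SharedMain.main⊆side mu q p (≢-sym v≢w) irr k∈S v∈k j∈S j≢w j≢v j∈i)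
         ]′ (eliminate⁻ S v b i j∈k)))
    ... | yes refl = subst (Has (eliminate S w c i) k) (sym (exchange-w v b w c d))
      (x∈p∧x≢y⇒x∈p-y (v∈cols p) v≢w , entry (eliminate⁻ S v b i j∈k))
      where
      entry : w ∈ E S k d ⊎ (v ∈ E S k (not b) × w ∈ E S i d) → v ∈ E (eliminate S w c i) k (twist b c d)
      entry (inj₁ w∈k) with refl ← not-≢ {d} {c} (λ { refl → k≢i (unique q k k∈S w∈k) }) =
        subst (λ e → v ∈ E (eliminate S w c i) k e)
          (sym (trans (twist-not b c c) (trans (cong not (twist-same b c)) (not-involutive b))))
          (eliminate-new S w c i w∈k (v∈Ei p))
      entry (inj₂ (v∈k , w∈i)) with refl ← no-clash mu (i∈rows q) (v∈cols q) w∈i (v∈Ei q) =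
        subst (λ e → v ∈ E (eliminate S w c i) k e) (sym (twist-same b c)) (eliminate-old S w c i v∈k)
    match : ∀ {k} → k ∈ rows S - i → Match (exchange v b w c) (eliminate S v b i) k (eliminate S w c i) k
    match {k} k∈ x = forward p q v≢w irr₂ k∈ x , λ h →
      subst (Has (eliminate S v b i) k) (exchange-inverse (≢-sym v≢w) x)
        (forward q p (≢-sym v≢w) irr₁ k∈ (exchange v b w c x) h)

  Confluent : State m n → Set
  Confluent S = ∀ {T T′} → Reach S T → Reach S T′ → T ≃ T′

  infix 4 _∼_
  -- `S ∼ S` is confluence of `S`, so this relation is not reflexive by itself. Transitivity passes
  -- through an outcome of the middle state, which `reach` supplies.
  _∼_ : State m n → State m n → Set
  X ∼ Y = ∀ {T T′} → Reach X T → Reach Y T′ → T ≃ T′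

  ∼-sym : ∀ {X Y} → X ∼ Y → Y ∼ X
  ∼-sym eq r r′ = ≃-sym (eq r′ r)

  ∼-trans : ∀ {X Y Z} → MU₂ Y → X ∼ Y → Y ∼ Z → X ∼ Z
  ∼-trans mu eq eq′ r r′ = let T , r″ = reach _ mu ℕ.≤-refl in ≃-trans (eq r r″) (eq′ r″ r′)

  ≋⇒∼ : ∀ {X Y} → MU₂ X → MU₂ Y → Confluent Y → X ≋ Y → X ∼ Y
  ≋⇒∼ muX muY conf eq r r′ = let T , r″ , eq′ = reach-≋ muX muY eq r in ≃-trans (≋⇒≃ eq′) (conf r″ r′)

  module _ {S : State m n} (mu : MU₂ S)
    (ih : ∀ {X} → MU₂ X → size (cols X) < size (cols S) → Confluent X) where

    confluent-eliminate : ∀ {v b i} → Pivot S v b i → Confluent (eliminate S v b i)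
    confluent-eliminate p = ih (eliminate-MU₂ mu p) (size-eliminate mu p)

    same-var : ∀ {v b c i j} → Pivot S v b i → Pivot S v c j → eliminate S v b i ∼ eliminate S v c j
    same-var {v} {b} {c} {i} {j} p q with b ≟ᴮ c
    ... | yes refl with refl ← unique q i (i∈rows p) (v∈Ei p) = confluent-eliminate p
    ... | no b≢c = ≋⇒∼ (eliminate-MU₂ mu p) (eliminate-MU₂ mu q) (confluent-eliminate q)
      (flip-pivot mu (not-≢ b≢c) (not-≢ (≢-sym b≢c)) p q)

    -- The two commuting reductions close a square up to `_≋_`; by induction, every outcome of
    -- either intermediate state is isomorphic to one reached through the closing corner.
    distinct-main : ∀ {v b w c i j} → Pivot S v b i → Pivot S w c j → i ≢ j →
      eliminate S v b i ∼ eliminate S w c j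
    distinct-main {v} {b} {w} {c} {i} {j} p q i≢j with v ≟ w
    ... | yes refl = same-var p q
    ... | no v≢w = λ r r′ →
      let p′ = pivot-after mu p q v≢w i≢j
          q′ = pivot-after mu q p (≢-sym v≢w) (≢-sym i≢j)
          muX = eliminate-MU₂ mu p ; muY = eliminate-MU₂ mu q
          muX′ = eliminate-MU₂ muX p′ ; muY′ = eliminate-MU₂ muY q′
          T , t = reach _ muX′ ℕ.≤-refl
          T′ , t′ , eq = reach-≋ muX′ muY′ eliminate-comm t
      in ≃-trans (confluent-eliminate p r (step p′ t))
           (≃-trans (≋⇒≃ eq) (confluent-eliminate q (step q′ t′) r′))

    -- If `i` contains `(u , d)`, every side clause of `v` receives it, so there is only one side
    -- clause; `v` can then be reduced from its other sign, with that clause as main clause. If not,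
    -- `u` is singular already in `S`, with main clause `k` different from `i`. Either way, the
    -- detour leaves `i` as main clause.
    shared-main-reducible : ∀ {v b w c i u d k} → Pivot S v b i → Pivot S w c i → v ≢ w →
      Pivot (eliminate S v b i) u d k → eliminate S v b i ∼ eliminate S w c i
    shared-main-reducible {v} {b} {w} {c} {i} {u} {d} {k} p q v≢w r
      with k∈S , k≢i ← x∈p-y⁻ (rows S) (i∈rows r) | u∈S , u≢v ← x∈p-y⁻ (cols S) (v∈cols r)
      with u ∈? E S i d
    ... | yes u∈i with l , l∈ , v∈l ← literal-occurs S (critical mu) (v∈cols p) (not b) =
      ∼-trans (eliminate-MU₂ mu p′) (same-var p p′) (distinct-main p′ q (pivot-≢ mu p v∈l))
      where
      side-row : ∀ k′ → k′ ∈ rows S → v ∈ E S k′ (not b) → k′ ≡ k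
      side-row k′ k′∈ v∈k′ = unique r k′ (x∈p∧x≢y⇒x∈p-y k′∈ (pivot-≢ mu p v∈k′)) (eliminate-new S v b i v∈k′ u∈i)
      p′ : Pivot S v (not b) l
      p′ = record { v∈cols = v∈cols p ; i∈rows = l∈ ; v∈Ei = v∈l
                  ; unique = λ k′ k′∈ v∈k′ → trans (side-row k′ k′∈ v∈k′) (sym (side-row l l∈ v∈l)) }
    ... | no u∉i =
      ∼-trans (eliminate-MU₂ mu r′) (distinct-main p r′ (≢-sym k≢i)) (distinct-main r′ q k≢i)
      where
      r′ : Pivot S u d k
      r′ = record
        { v∈cols = u∈S ; i∈rows = k∈S
        ; v∈Ei = [ id , (λ (_ , u∈i) → contradiction u∈i u∉i) ]′ (eliminate⁻ S v b i (v∈Ei r))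
        ; unique = λ k′ k′∈ u∈k′ → unique r k′ (x∈p∧x≢y⇒x∈p-y k′∈ λ { refl → u∉i u∈k′ }) (eliminate-old S v b i u∈k′)
        }

    reductions-∼ : ∀ {v b w c i j} → Pivot S v b i → Pivot S w c j → eliminate S v b i ∼ eliminate S w c j
    reductions-∼ {v} {b} {w} {c} {i} {j} p q with i ≟ j | v ≟ w
    ... | no i≢j | _ = distinct-main p q i≢j
    ... | yes refl | yes refl = same-var p q
    ... | yes refl | no v≢w with pivot? (eliminate S v b i) | pivot? (eliminate S w c i)
    ...   | yes (_ , _ , _ , r) | _ = shared-main-reducible p q v≢w r
    ...   | no _ | yes (_ , _ , _ , r) = ∼-sym (shared-main-reducible q p (≢-sym v≢w) r)
    ...   | no none₁ | no none₂ = both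
      where
      both : eliminate S v b i ∼ eliminate S w c i
      both (step r _) _ = contradiction (_ , _ , _ , r) none₁
      both (done _) (step r _) = contradiction (_ , _ , _ , r) none₂
      both (done irr₁) (done irr₂) = shared-main-≃ mu p q v≢w irr₁ irr₂

    confluent-step : Confluent S
    confluent-step (done _) (done _) = ≋⇒≃ ≋-refl
    confluent-step (done irr) (step q _) = contradiction q (irr _ _ _)
    confluent-step (step p _) (done irr) = contradiction p (irr _ _ _)
    confluent-step (step p r) (step q r′) = reductions-∼ p q r r′

  confluent : ∀ d {S} → MU₂ S → size (cols S) < d → Confluent S
  confluent (suc d) mu S<d = confluent-step mu λ muX X<S → confluent d muX (ℕ.<-≤-trans X<S (ℕ.≤-pred S<d))

-- Clause-sets as lists

open import Data.Integer.Base using (+_)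
import Data.Integer as ℤ
import Data.Integer.Properties as ℤ

i-j≡k⇒i≡k+j : ∀ i j k → + i ℤ.- + j ≡ + k → i ≡ k + j
i-j≡k⇒i≡k+j i j k eq = ℤ.+-injective (begin
  + i                          ≡⟨ ℤ.+-identityʳ (+ i) ⟨
  + i ℤ.+ ℤ.0ℤ                 ≡⟨ cong (λ x → + i ℤ.+ x) (ℤ.+-inverseˡ (+ j)) ⟨
  + i ℤ.+ (ℤ.- + j ℤ.+ + j)    ≡⟨ ℤ.+-assoc (+ i) (ℤ.- + j) (+ j) ⟨
  (+ i ℤ.- + j) ℤ.+ + j        ≡⟨ cong (λ x → x ℤ.+ + j) eq ⟩
  + k ℤ.+ + j                  ∎)
  where open ≡-Reasoning

lookup-injective : ∀ {a r} {A : Set a} {R : A → A → Set r} {xs} → AllPairs (λ x y → ¬ R x y) xs →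
  (∀ {x y} → R x y → R y x) → ∀ i j → R (List.lookup xs i) (List.lookup xs j) → i ≡ j
lookup-injective (_ ∷ _) sym zero zero _ = refl
lookup-injective (x∉ ∷ _) sym zero (suc j) r = contradiction r (All.lookup x∉ (∈-lookup j))
lookup-injective (x∉ ∷ _) sym (suc i) zero r = contradiction (sym r) (All.lookup x∉ (∈-lookup i))
lookup-injective (_ ∷ xs!) sym (suc i) (suc j) r = cong suc (lookup-injective xs! sym i j r)

module Cardinality {c ℓ} (D : DecSetoid c ℓ) where

  open DecSetoid D using (Carrier; _≈_; setoid)
    renaming (_≟_ to _≟ᴰ_; refl to ≈-refl; sym to ≈-sym; trans to ≈-trans)
  open FiniteSets D using (card) renaming (_∈_ to _∈ᴰ_)

  dedup : List Carrier → List Carrier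
  dedup = deduplicate _≟ᴰ_

  dedup⁺ : ∀ {xs x} → x ∈ᴰ xs → x ∈ᴰ dedup xs
  dedup⁺ = Membership.∈-deduplicate⁺ setoid _≟ᴰ_ (λ y≈z x≈y → ≈-trans x≈y (≈-sym y≈z))

  dedup⁻ : ∀ xs {x} → x ∈ᴰ dedup xs → x ∈ᴰ xs
  dedup⁻ xs = Membership.∈-deduplicate⁻ setoid _≟ᴰ_ xs

  card≡1⁻ : ∀ {xs} → card xs ≡ 1 → ∃[ x ] x ∈ᴰ xs × (∀ {y} → y ∈ᴰ xs → y ≈ x)
  card≡1⁻ {xs} eq with dedup xs in eq′
  ... | x ∷ [] = x , dedup⁻ xs (subst (x ∈ᴰ_) (sym eq′) (here ≈-refl)) ,
    λ {y} y∈ → only (subst (y ∈ᴰ_) eq′ (dedup⁺ y∈))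
    where
    only : ∀ {y} → y ∈ᴰ x ∷ [] → y ≈ x
    only (here y≈x) = y≈x
  card≡1⁻ {xs} () | []
  card≡1⁻ {xs} () | _ ∷ _ ∷ _

  card≡1⁺ : ∀ {xs x} → x ∈ᴰ xs → (∀ {y} → y ∈ᴰ xs → y ≈ x) → card xs ≡ 1
  card≡1⁺ {xs} {x} x∈ only = all-equal (dedup xs) (deduplicate-! D xs) (dedup⁺ x∈) (λ y∈ → only (dedup⁻ xs y∈))
    where
    all-equal : ∀ ys → AllPairs (λ y z → ¬ (y ≈ z)) ys → x ∈ᴰ ys → (∀ {y} → y ∈ᴰ ys → y ≈ x) → length ys ≡ 1
    all-equal (y ∷ []) _ _ _ = refl
    all-equal (y ∷ z ∷ _) ((y≉z All.∷ _) ∷ _) _ only =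
      contradiction (≈-trans (only (here ≈-refl)) (≈-sym (only (there (here ≈-refl))))) y≉z

  0<card : ∀ {xs x} → x ∈ᴰ xs → 0 < card xs
  0<card x∈ = Membership.∈-length setoid (dedup⁺ x∈)

-- Translation between lists of clauses and states

module Bridge {a} {V : Set a} (_≟ⱽ_ : DecidableEquality V) where

  open ClauseSets _≟ⱽ_ hiding (_∩_; _∪_; _∖_; n; c)
  open State using (rows; cols; E; literal-occurs)

  infix 4 _≐_
  _≐_ : Clause → Clause → Set a
  C ≐ D = literals C Lits.≐ literals D

  ≐-refl : ∀ {K} → K Lits.≐ K
  ≐-refl = id , id

  ≐-sym : ∀ {K L} → K Lits.≐ L → L Lits.≐ K
  ≐-sym (p , q) = q , p

  ≐-trans : ∀ {K L M} → K Lits.≐ L → L Lits.≐ M → K Lits.≐ M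
  ≐-trans (p , q) (p′ , q′) = p′ ∘ p , q ∘ q′

  clausesDecSetoid : DecSetoid _ _
  clausesDecSetoid = On.decSetoid Lits.decSetoid literals

  module CardC = Cardinality clausesDecSetoid
  module CardV = Cardinality (≡.decSetoid _≟ⱽ_)

  ∈⇒∈ᶜ : ∀ {C F} → C ∈ₗ F → C ∈ᶜ F
  ∈⇒∈ᶜ C∈ = lose C∈ ≐-refl

  Containing : Literal → ClauseSet → ClauseSet
  Containing x F = filter (λ C → x Lits.∈? literals C) F

  ldeg≡1⁻ : ∀ {F x} → ldeg F x ≡ 1 →
    ∃[ C ] C ∈ₗ F × x ∈ₗ literals C × (∀ {D} → D ∈ₗ F → x ∈ₗ literals D → D ≐ C)
  ldeg≡1⁻ {F} {x} eq with C , C∈ , only ← CardC.card≡1⁻ {Containing x F} eq with D , D∈ , C≐D ← find C∈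
                     with D∈F , x∈D ← ∈-filter⁻ (λ C → x Lits.∈? literals C) {xs = F} D∈ =
    D , D∈F , x∈D , λ {B} B∈F x∈B →
      ≐-trans (only {B} (∈⇒∈ᶜ (∈-filter⁺ (λ C → x Lits.∈? literals C) B∈F x∈B))) C≐D

  ldeg≡1⁺ : ∀ {F x C} → C ∈ₗ F → x ∈ₗ literals C → (∀ {D} → D ∈ₗ F → x ∈ₗ literals D → D ≐ C) → ldeg F x ≡ 1
  ldeg≡1⁺ {F} {x} {C} C∈ x∈ only = CardC.card≡1⁺ {x = C}
    (∈⇒∈ᶜ (∈-filter⁺ (λ C → x Lits.∈? literals C) C∈ x∈))
    λ D∈ → let B , B∈ , D≐B = find D∈
               B∈F , x∈B = ∈-filter⁻ (λ C → x Lits.∈? literals C) {xs = F} B∈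
           in ≐-trans D≐B (only B∈F x∈B)

  0<ldeg : ∀ {F x C} → C ∈ₗ F → x ∈ₗ literals C → 0 < ldeg F x
  0<ldeg {F} {x} {C} C∈ x∈ = CardC.0<card {x = C} (∈⇒∈ᶜ (∈-filter⁺ (λ C → x Lits.∈? literals C) C∈ x∈))

  singular⁻ : ∀ {v F} → Singular v F → ∃[ b ] ldeg F (v , b) ≡ 1
  singular⁻ {v} {F} s with ℕ.⊓-sel (ldeg F (pos v)) (ldeg F (neg v))
  ... | inj₁ eq = true , trans (sym eq) s
  ... | inj₂ eq = false , trans (sym eq) s

  singular⁺ : ∀ {v F} b → ldeg F (v , b) ≡ 1 → 0 < ldeg F (v , not b) → Singular v F
  singular⁺ {v} {F} true one other =
    trans (ℕ.m≤n⇒m⊓n≡m (subst (_≤ ldeg F (neg v)) (sym one) other)) one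
  singular⁺ {v} {F} false one other =
    trans (ℕ.m≥n⇒m⊓n≡n (subst (_≤ ldeg F (pos v)) (sym one) other)) one

  DP⁻ : ∀ {v F D} → D ∈ₗ DP v F → (D ∈ₗ F × v ∉ₗ vars D) ⊎
    ∃[ B ] ∃[ C ] B ∈ₗ F × C ∈ₗ F × (∃[ r ] D ≡ resolvent v B C r)
  DP⁻ {v} {F} {D} D∈ with ∈-++⁻ (filter (λ C → v Vars.∉? vars C) F) D∈
  ... | inj₁ D∈ = inj₁ (∈-filter⁻ (λ C → v Vars.∉? vars C) {xs = F} D∈)
  ... | inj₂ D∈ with B , B∈ , D∈B ← find (∈-concatMap⁻ (λ B → concatMap (resolvents v B) F) D∈)
                with C , C∈ , D∈BC ← find (∈-concatMap⁻ (resolvents v B) D∈B) =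
    inj₂ (B , C , B∈ , C∈ , from-resolvents D∈BC)
    where
    from-resolvents : D ∈ₗ resolvents v B C → ∃[ r ] D ≡ resolvent v B C r
    from-resolvents D∈ with resolvable? v B C
    from-resolvents (here eq) | yes r = r , eq

  DP⁺-unchanged : ∀ {v F D} → D ∈ₗ F → v ∉ₗ vars D → D ∈ₗ DP v F
  DP⁺-unchanged {v} {F} D∈ v∉ = ∈-++⁺ˡ (∈-filter⁺ (λ C → v Vars.∉? vars C) D∈ v∉)

  DP⁺-resolvent : ∀ {v F B C} → B ∈ₗ F → C ∈ₗ F → Resolvable v B C → ∃[ r ] resolvent v B C r ∈ₗ DP v F
  DP⁺-resolvent {v} {F} {B} {C} B∈ C∈ r =
    let r′ , ∈BC = in-resolvents in
    r′ , ∈-++⁺ʳ (filter (λ C → v Vars.∉? vars C) F)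
      (∈-concatMap⁺ (λ B → concatMap (resolvents v B) F) (lose B∈ (∈-concatMap⁺ (resolvents v B) (lose C∈ ∈BC))))
    where
    in-resolvents : ∃[ r ] resolvent v B C r ∈ₗ resolvents v B C
    in-resolvents with resolvable? v B C
    ... | yes r = r , here refl
    ... | no ¬r = contradiction r ¬r

  resolvable⁻ : ∀ {v B C} → Resolvable v B C → pos v ∈ₗ literals B × neg v ∈ₗ literals C
  resolvable⁻ {v} {B} {C} r
    with p∈B , p∈C̄ ← ∈-filter⁻ (Lits._∈? complements (literals C)) {xs = literals B} (rhs≤lhs r (here refl))
    with (.v , false) , x∈C , refl ← ∈-map⁻ complement p∈C̄ = p∈B , x∈C

  resolvable⁺ : ∀ {v B C} → pos v ∈ₗ literals B → neg v ∈ₗ literals C →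
    (∀ {x} → x ∈ₗ literals B → complement x ∈ₗ literals C → x ≡ pos v) → Resolvable v B C
  resolvable⁺ {v} {B} {C} p∈B n∈C only =
    (λ x∈ → let x∈B , x∈C̄ = ∈-filter⁻ (Lits._∈? complements (literals C)) {xs = literals B} x∈
                y , y∈C , x≡ȳ = ∈-map⁻ complement x∈C̄
            in here (only x∈B (subst (_∈ₗ literals C)
                 (sym (trans (cong complement x≡ȳ) (complement-involutive y))) y∈C))) ,
    (λ { (here refl) → ∈-filter⁺ (Lits._∈? complements (literals C)) p∈B (∈-map⁺ complement n∈C) })

  resolvent⁻ : ∀ {v B C x} r → x ∈ₗ literals (resolvent v B C r) →
    (x ∈ₗ literals B ⊎ x ∈ₗ literals C) × var x ≢ v
  resolvent⁻ {v} {B} {C} {x} r x∈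
    with x∈K , x∉ ← ∈-filter⁻ (Lits._∉? pos v ∷ neg v ∷ []) {xs = literals B ++ literals C} x∈ =
    ∈-++⁻ (literals B) x∈K , var-≢ x x∉
    where
    var-≢ : ∀ x → x ∉ₗ pos v ∷ neg v ∷ [] → var x ≢ v
    var-≢ (_ , true) x∉ refl = x∉ (here refl)
    var-≢ (_ , false) x∉ refl = x∉ (there (here refl))

  resolvent⁺ : ∀ {v B C x} r → x ∈ₗ literals B ⊎ x ∈ₗ literals C → var x ≢ v →
    x ∈ₗ literals (resolvent v B C r)
  resolvent⁺ {v} {B} {C} {x} r x∈ x≢v = ∈-filter⁺ (Lits._∉? pos v ∷ neg v ∷ [])
    ([ ∈-++⁺ˡ , ∈-++⁺ʳ (literals B) ]′ x∈)
    λ { (here refl) → x≢v refl ; (there (here refl)) → x≢v refl }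

  module Encoding {n : ℕ} (e : Fin n → V) (e-injective : ∀ {i j} → e i ≡ e j → i ≡ j) where

    lit : Fin n × Bool → Literal
    lit (j , b) = e j , b

    lit-injective : ∀ {x y} → lit x ≡ lit y → x ≡ y
    lit-injective eq = cong₂ _,_ (e-injective (cong proj₁ eq)) (cong proj₂ eq)

    split-var : ∀ v → (∃[ j ] e j ≡ v) ⊎ (∀ j → e j ≢ v)
    split-var v with any? (λ j → e j ≟ⱽ v)
    ... | yes found = inj₁ found
    ... | no none = inj₂ λ j eq → none (j , eq)

    assignment : (Fin n → Bool) → V → Bool
    assignment φ v = [ φ ∘ proj₁ , const true ]′ (split-var v)

    assignment-at : ∀ φ j → assignment φ (e j) ≡ φ j
    assignment-at φ j with split-var (e j)
    ... | inj₁ (i , eq) = cong φ (e-injective eq)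
    ... | inj₂ none = contradiction refl (none j)

    -- The identity outside the image of `e`, so that bijections extend to all literals over `V`.
    extension : (Fin n × Bool → Fin n × Bool) → Literal → Literal
    extension f (v , b) = [ (λ (j , _) → lit (f (j , b))) , (λ _ → v , b) ]′ (split-var v)

    extension-lit : ∀ f y → extension f (lit y) ≡ lit (f y)
    extension-lit f (j , b) with split-var (e j)
    ... | inj₁ (k , eq) = cong (λ l → lit (f (l , b))) (e-injective eq)
    ... | inj₂ none = contradiction refl (none j)

    extension-other : ∀ f {v b} → (∀ j → e j ≢ v) → extension f (v , b) ≡ (v , b)
    extension-other f {v} none with split-var v
    ... | inj₁ (j , eq) = contradiction eq (none j)
    ... | inj₂ _ = refl

    extension-inverse : ∀ f g → (∀ y → f (g y) ≡ y) → ∀ x → extension f (extension g x) ≡ x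
    extension-inverse f g inv (v , b) = by-cases (split-var v)
      where
      by-cases : (∃[ j ] e j ≡ v) ⊎ (∀ j → e j ≢ v) → extension f (extension g (v , b)) ≡ (v , b)
      by-cases (inj₁ (j , refl)) = trans (cong (extension f) (extension-lit g (j , b)))
        (trans (extension-lit f (g (j , b))) (cong lit (inv (j , b))))
      by-cases (inj₂ none) = trans (cong (extension f) (extension-other g none)) (extension-other f none)

    private
      module Fins = ClauseSets {V = Fin n} _≟_

    extend-bijection : Fins.LiteralBijection → LiteralBijection
    extend-bijection α = record
      { bijection = mk↔ₛ′ (extension to) (extension from)
          (extension-inverse to from (Inverse.strictlyInverseˡ bijection))
          (extension-inverse from to strictlyInverseʳ)
      ; commutes = λ (v , b) → by-cases v b (split-var v)
      }
      where
      open Fins.LiteralBijection α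
      by-cases : ∀ v b → (∃[ j ] e j ≡ v) ⊎ (∀ j → e j ≢ v) →
        extension to (v , not b) ≡ complement (extension to (v , b))
      by-cases v b (inj₁ (j , refl)) = trans (extension-lit to (j , not b))
        (trans (cong lit (commutes (j , b))) (cong complement (sym (extension-lit to (j , b)))))
      by-cases v b (inj₂ none) = trans (extension-other to none) (cong complement (sym (extension-other to none)))

    module _ {m : ℕ} where

      record Row (S : State m n) (k : Fin m) (C : Clause) : Set a where
        field
          encode : ∀ x → x ∈ₗ literals C → ∃[ y ] x ≡ lit y × Has S k y
          decode : ∀ y → Has S k y → lit y ∈ₗ literals C

        has : ∀ y → lit y ∈ₗ literals C → Has S k y
        has y y∈ = let z , eq , h = encode (lit y) y∈ in subst (Has S k) (sym (lit-injective eq)) h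

      open Row

      -- A correspondence instead of a bijection, since a list may contain a clause several times.
      record Represents (S : State m n) (F : ClauseSet) : Set a where
        field
          rowOf    : ∀ C → C ∈ₗ F → ∃[ k ] k ∈ rows S × Row S k C
          clauseOf : ∀ k → k ∈ rows S → ∃[ C ] C ∈ₗ F × Row S k C

      open Represents

      row-≐ : ∀ {S k C D} → literals C Lits.≐ literals D → Row S k C → Row S k D
      row-≐ (C⊆D , D⊆C) ρ = record { encode = λ x x∈ → encode ρ x (D⊆C x∈) ; decode = λ y h → C⊆D (decode ρ y h) }

      row-unique : ∀ {S k C D} → Row S k C → Row S k D → literals C Lits.≐ literals D
      row-unique ρ σ = ⊆ ρ σ , ⊆ σ ρ
        where
        ⊆ : ∀ {S k C D} → Row S k C → Row S k D → literals C Lits.⊆ literals D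
        ⊆ ρ σ x∈ with y , refl , h ← encode ρ _ x∈ = decode σ y h

      represents-≐ᶜ : ∀ {S F G} → F ≐ᶜ G → Represents S F → Represents S G
      represents-≐ᶜ (F⊆G , G⊆F) R = record
        { rowOf = λ C C∈ → let D , D∈ , C≐D = find {P = λ X → literals C Lits.≐ literals X} (G⊆F {C} (∈⇒∈ᶜ C∈)) ; k , k∈ , ρ = rowOf R D D∈
                         in k , k∈ , row-≐ (≐-sym C≐D) ρ
        ; clauseOf = λ k k∈ → let C , C∈ , ρ = clauseOf R k k∈ ; D , D∈ , C≐D = find {P = λ X → literals C Lits.≐ literals X} (F⊆G {C} (∈⇒∈ᶜ C∈))
                            in D , D∈ , row-≐ C≐D ρ
        }

      pivot⁺ : ∀ {S F v b} → MU₂ S → Represents S F → ldeg F (v , b) ≡ 1 → ∃[ u ] v ≡ e u × ∃[ i ] Pivot S u b i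
      pivot⁺ {S} {F} {v} {b} mu R one
        with C , C∈ , x∈C , only ← ldeg≡1⁻ {F} {v , b} one
        with i , i∈ , ρ ← rowOf R C C∈
        with (u , _) , refl , u∈cols , u∈i ← encode ρ (v , b) x∈C =
        u , refl , i , record { v∈cols = u∈cols ; i∈rows = i∈ ; v∈Ei = u∈i ; unique = unique′ }
        where
        unique′ : ∀ k → k ∈ rows S → u ∈ E S k b → k ≡ i
        unique′ k k∈ u∈k with D , D∈ , σ ← clauseOf R k k∈ = distinct mu k∈ i∈
          λ y h → has ρ y (lhs≤rhs (only D∈ (decode σ (u , b) (u∈cols , u∈k))) (decode σ y h))

      irreducible : ∀ {S F} → MU₂ S → Represents S F → Nonsingular F → Irreducible S
      irreducible {S} {F} mu R nonsing u b i p
        with C , C∈ , ρ ← clauseOf R i (i∈rows p)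
        -- The complementary literal occurs too, so the minimum of the two degrees is 1 and not 0.
        with k , k∈ , u∈k ← literal-occurs S (critical mu) (v∈cols p) (not b)
        with D , D∈ , σ ← clauseOf R k k∈ =
        nonsing (e u) (singular⁺ {e u} {F} b
          (ldeg≡1⁺ {F} C∈ (decode ρ (u , b) (v∈cols p , v∈Ei p)) (only ρ))
          (0<ldeg {F} D∈ (decode σ (u , not b) (v∈cols p , u∈k))))
        where
        only : ∀ {B C} → Row S i C → B ∈ₗ F → lit (u , b) ∈ₗ literals B → literals B Lits.≐ literals C
        only {B} ρ B∈ u∈B with l , l∈ , τ ← rowOf R B B∈
                        with refl ← unique p l l∈ (proj₂ (has τ (u , b) u∈B)) =
          row-unique τ ρ

      resolvent-row : ∀ {S u b i k B C D} → u ∈ E S k (not b) → Row S i B → Row S k C →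
        (∀ x → x ∈ₗ literals D → (x ∈ₗ literals B ⊎ x ∈ₗ literals C) × var x ≢ e u) →
        (∀ x → x ∈ₗ literals B ⊎ x ∈ₗ literals C → var x ≢ e u → x ∈ₗ literals D) →
        Row (eliminate S u b i) k D
      resolvent-row {S} {u} {b} {i} {k} {B} {C} {D} u∈k ρ σ D⊆ ⊆D = record
        { encode = λ x x∈ → let x∈BC , x≢u = D⊆ x x∈ in from x x∈BC x≢u
        ; decode = λ { (j , d) (j∈ , j∈k) → ⊆D (e j , d) (into j d (proj₁ (x∈p-y⁻ (cols S) j∈)) (eliminate⁻ S u b i j∈k))
                       λ eq → proj₂ (x∈p-y⁻ (cols S) j∈) (e-injective eq) }
        }
        where
        from : ∀ x → x ∈ₗ literals B ⊎ x ∈ₗ literals C → var x ≢ e u → ∃[ y ] x ≡ lit y × Has (eliminate S u b i) k y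
        from x (inj₁ x∈B) x≢u with (j , d) , refl , j∈ , j∈i ← encode ρ x x∈B =
          (j , d) , refl , x∈p∧x≢y⇒x∈p-y j∈ (λ { refl → x≢u refl }) , eliminate-new S u b i u∈k j∈i
        from x (inj₂ x∈C) x≢u with (j , d) , refl , j∈ , j∈k ← encode σ x x∈C =
          (j , d) , refl , x∈p∧x≢y⇒x∈p-y j∈ (λ { refl → x≢u refl }) , eliminate-old S u b i j∈k
        into : ∀ j d → j ∈ cols S → j ∈ E S k d ⊎ (u ∈ E S k (not b) × j ∈ E S i d) →
          lit (j , d) ∈ₗ literals B ⊎ lit (j , d) ∈ₗ literals C
        into j d j∈ (inj₁ j∈k) = inj₂ (decode σ (j , d) (j∈ , j∈k))
        into j d j∈ (inj₂ (_ , j∈i)) = inj₁ (decode ρ (j , d) (j∈ , j∈i))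

      unchanged-row : ∀ {S u b i k C} → u ∉ E S k (not b) → e u ∉ₗ vars C → Row S k C → Row (eliminate S u b i) k C
      unchanged-row {S} {u} {b} {i} {k} {C} u∉k u∉C σ = record
        { encode = λ x x∈ → from x x∈
        ; decode = λ { (j , d) (j∈ , j∈k) → decode σ (j , d) (proj₁ (x∈p-y⁻ (cols S) j∈) ,
                         [ id , (λ (u∈k , _) → contradiction u∈k u∉k) ]′ (eliminate⁻ S u b i j∈k)) }
        }
        where
        from : ∀ x → x ∈ₗ literals C → ∃[ y ] x ≡ lit y × Has (eliminate S u b i) k y
        from x x∈ with (j , d) , refl , j∈ , j∈k ← encode σ x x∈ = (j , d) , refl ,
          x∈p∧x≢y⇒x∈p-y j∈ (λ { refl → u∉C (∈-map⁺ var x∈) }) , eliminate-old S u b i j∈k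

      -- Only row `i` contains `(u , b)`, so every resolvent pairs it with a side clause, whose
      -- index can store the result. Conversely, each side clause does resolve with `i`, by `clash`.
      represents-DP : ∀ {S F u b i} → MU₂ S → Pivot S u b i → Represents S F →
        Represents (eliminate S u b i) (DP (e u) F)
      represents-DP {S} {F} {u} {b} {i} mu p R = record { rowOf = row′ ; clauseOf = clause′ }
        where
        S′ : State m n
        S′ = eliminate S u b i

        row-of-resolvent : ∀ b → Pivot S u b i → ∀ {B C k l} r → k ∈ rows S → l ∈ rows S → Row S k B → Row S l C →
          ∃[ o ] o ∈ rows S - i × Row (eliminate S u b i) o (resolvent (e u) B C r)
        row-of-resolvent b p {B} {C} {k} {l} r k∈ l∈ ρ σ
          with pos∈B , neg∈C ← resolvable⁻ {e u} {B} {C} r with b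
        ... | true with refl ← unique p k k∈ (proj₂ (has ρ (u , true) pos∈B)) =
          l , x∈p∧x≢y⇒x∈p-y l∈ (pivot-≢ mu p u∈l) ,
          resolvent-row u∈l ρ σ (λ x → resolvent⁻ {B = B} {C} r) (λ x → resolvent⁺ {B = B} {C} r)
          where
          u∈l : u ∈ E S l false
          u∈l = proj₂ (has σ (u , false) neg∈C)
        ... | false with refl ← unique p l l∈ (proj₂ (has σ (u , false) neg∈C)) =
          k , x∈p∧x≢y⇒x∈p-y k∈ (pivot-≢ mu p u∈k) ,
          resolvent-row u∈k σ ρ
            (λ x x∈ → let x∈BC , x≢u = resolvent⁻ {B = B} {C} r x∈ in [ inj₂ , inj₁ ]′ x∈BC , x≢u)
            (λ x x∈ → resolvent⁺ {B = B} {C} r ([ inj₂ , inj₁ ]′ x∈))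
          where
          u∈k : u ∈ E S k true
          u∈k = proj₂ (has ρ (u , true) pos∈B)

        row′ : ∀ D → D ∈ₗ DP (e u) F → ∃[ k ] k ∈ rows S′ × Row S′ k D
        row′ D D∈ with DP⁻ {e u} {F} D∈
        ... | inj₁ (D∈F , u∉D) with k , k∈ , ρ ← rowOf R D D∈F =
          k , x∈p∧x≢y⇒x∈p-y k∈ (λ { refl → u∉D (∈-map⁺ var (decode ρ (u , b) (v∈cols p , v∈Ei p))) }) ,
          unchanged-row (λ u∈k → u∉D (∈-map⁺ var (decode ρ (u , not b) (v∈cols p , u∈k)))) u∉D ρ
        ... | inj₂ (B , C , B∈ , C∈ , r , refl) with k , k∈ , ρ ← rowOf R B B∈ | l , l∈ , σ ← rowOf R C C∈ =
          row-of-resolvent b p r k∈ l∈ ρ σ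

        clash : ∀ {k j d d′} → k ∈ rows S → u ∈ E S k (not b) → Has S i (j , d) → Has S k (j , d′) → d′ ≡ not d → j ≡ u × d ≡ b
        clash {k} {j} {d} k∈ u∈k (j∈ , j∈i) (_ , j∈k) d′≡¬d with j ≟ u
        ... | yes refl = refl , no-clash mu (i∈rows p) j∈ j∈i (v∈Ei p)
        ... | no j≢u = contradiction (trans (clash-only-at-pivot mu p k∈ u∈k j∈ j≢u j∈i j∈k) d′≡¬d) (not-¬ refl)

        -- `Resolvable` expects the clause with the positive literal first, so the order of `C₀` and
        -- `C` depends on `b`.
        resolve : ∀ {k C₀ C} → k ∈ rows S → u ∈ E S k (not b) → C₀ ∈ₗ F → Row S i C₀ → C ∈ₗ F → Row S k C →
          ∀ b′ → b′ ≡ b → ∃[ D ] D ∈ₗ DP (e u) F × Row S′ k D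
        resolve {k} {C₀} {C} k∈ u∈k C₀∈ ρ C∈ σ true refl =
          let r , r∈ = DP⁺-resolvent {e u} {F} C₀∈ C∈ (resolvable⁺ {e u} {C₀} {C}
                (decode ρ (u , true) (v∈cols p , v∈Ei p)) (decode σ (u , false) (v∈cols p , u∈k)) only)
          in _ , r∈ , resolvent-row u∈k ρ σ (λ x → resolvent⁻ {B = C₀} {C} r) (λ x → resolvent⁺ {B = C₀} {C} r)
          where
          only : ∀ {x} → x ∈ₗ literals C₀ → complement x ∈ₗ literals C → x ≡ pos (e u)
          only {x} x∈ x̄∈ with (j , d) , refl , h ← encode ρ x x∈
                         with refl , refl ← clash k∈ u∈k h (has σ (j , not d) x̄∈) refl = refl
        resolve {k} {C₀} {C} k∈ u∈k C₀∈ ρ C∈ σ false refl =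
          let r , r∈ = DP⁺-resolvent {e u} {F} C∈ C₀∈ (resolvable⁺ {e u} {C} {C₀}
                (decode σ (u , true) (v∈cols p , u∈k)) (decode ρ (u , false) (v∈cols p , v∈Ei p)) only)
          in _ , r∈ , resolvent-row u∈k ρ σ
               (λ x x∈ → let x∈BC , x≢u = resolvent⁻ {B = C} {C₀} r x∈ in [ inj₂ , inj₁ ]′ x∈BC , x≢u)
               (λ x x∈ → resolvent⁺ {B = C} {C₀} r ([ inj₂ , inj₁ ]′ x∈))
          where
          only : ∀ {x} → x ∈ₗ literals C → complement x ∈ₗ literals C₀ → x ≡ pos (e u)
          only {x} x∈ x̄∈ with (j , d) , refl , h ← encode σ x x∈
                         with refl , ¬d≡false ← clash k∈ u∈k (has ρ (j , not d) x̄∈) h (sym (not-involutive d)) =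
            cong (e u ,_) (trans (sym (not-involutive d)) (cong not ¬d≡false))

        clause′ : ∀ k → k ∈ rows S′ → ∃[ D ] D ∈ₗ DP (e u) F × Row S′ k D
        clause′ k k∈ with k∈S , k≢i ← x∈p-y⁻ (rows S) k∈ with C , C∈ , σ ← clauseOf R k k∈S with u ∈? E S k (not b)
        ... | yes u∈k = let C₀ , C₀∈ , ρ = clauseOf R i (i∈rows p) in resolve k∈S u∈k C₀∈ ρ C∈ σ b refl
        ... | no u∉k = C , DP⁺-unchanged {e u} {F} C∈ u∉C , unchanged-row u∉k u∉C σ
          where
          missing : ∀ d → u ∉ E S k d
          missing d u∈k with d ≟ᴮ b
          ... | yes refl = k≢i (unique p k k∈S u∈k)
          ... | no d≢b = u∉k (subst (λ d → u ∈ E S k d) (not-≢ d≢b) u∈k)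
          u∉C : e u ∉ₗ vars C
          u∉C u∈ with (_ , d) , x∈ , refl ← ∈-map⁻ var u∈ = missing d (proj₂ (has σ (u , d) x∈))

      reach-of-sDP : ∀ {S F G G′} → MU₂ S → Represents S F → Star _⇝_ F G → G ≐ᶜ G′ → Nonsingular G′ →
        ∃[ T ] Reach S T × Represents T G′
      reach-of-sDP {S} mu R ε G≐G′ nonsing =
        let R′ = represents-≐ᶜ G≐G′ R in S , done (irreducible mu R′ nonsing) , R′
      reach-of-sDP mu R (reduce {F} v _ sing ◅ steps) G≐G′ nonsing
        with b , one ← singular⁻ {v} {F} sing
        with u , refl , i , p ← pivot⁺ mu R one
        with T , r , R′ ← reach-of-sDP (eliminate-MU₂ mu p) (represents-DP mu p R) steps G≐G′ nonsing =
        T , step p r , R′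

      isomorphic : ∀ {S T G H} → Represents S G → Represents T H → S ≃ T → G ≅ H
      isomorphic {S} {T} {G} {H} R Q (α , eq) = β ,
        (λ {C} C∈ → let C′ , C′∈ , C≐C′ = find {P = λ X → literals C Lits.≐ literals X} C∈
                        D , D∈ , C′≡D = ∈-map⁻ (rename β) C′∈
                        k , k∈ , ρ = rowOf R D D∈ ; l , l∈ , mt = forth eq k∈ ; B , B∈ , σ = clauseOf Q l l∈
                    in lose B∈ (≐-trans C≐C′ (subst (λ X → literals X Lits.≐ literals B) (sym C′≡D) (renamed ρ σ mt)))) ,
        (λ {C} C∈ → let C′ , C′∈ , C≐C′ = find {P = λ X → literals C Lits.≐ literals X} C∈
                        l , l∈ , σ = rowOf Q C′ C′∈ ; k , k∈ , mt = back eq l∈ ; D , D∈ , ρ = clauseOf R k k∈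
                    in lose (∈-map⁺ (rename β) D∈) (≐-trans C≐C′ (≐-sym (renamed ρ σ mt))))
        where
        β : LiteralBijection
        β = extend-bijection α
        open Fins.LiteralBijection α
        renamed : ∀ {k l C D} → Row S k C → Row T l D → Match to S k T l →
          map (extension to) (literals C) Lits.≐ literals D
        renamed {k} {l} {C} {D} ρ σ mt = ⊆D , D⊆
          where
          ⊆D : map (extension to) (literals C) Lits.⊆ literals D
          ⊆D x∈ with y , y∈ , refl ← ∈-map⁻ (extension to) x∈ with z , refl , h ← encode ρ y y∈ =
            subst (_∈ₗ literals D) (sym (extension-lit to z)) (decode σ (to z) (proj₁ (mt z) h))
          D⊆ : literals D Lits.⊆ map (extension to) (literals C)
          D⊆ x∈ with y , refl , h ← encode σ _ x∈ =
            subst (_∈ₗ map (extension to) (literals C))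
              (trans (extension-lit to (from y)) (cong lit (to-from y)))
              (∈-map⁺ (extension to) (decode ρ (from y)
                (proj₂ (mt (from y)) (subst (Has T l) (sym (to-from y)) h))))
            where
            to-from : ∀ y → to (from y) ≡ y
            to-from = Inverse.strictlyInverseˡ bijection

  -- The state of a given clause-set

  module Initial (F : ClauseSet) (muF : MU F) where

    private
      -- The lengths of `cs` and `vs` are `c F` and `n F` by definition.
      cs : List Clause
      cs = CardC.dedup F

      vs : List V
      vs = CardV.dedup (concatMap vars F)

      clauseAt : Fin (length cs) → Clause
      clauseAt = List.lookup cs

    variableAt : Fin (length vs) → V
    variableAt = List.lookup vs

    variableAt-injective : ∀ {i j} → variableAt i ≡ variableAt j → i ≡ j
    variableAt-injective = lookup-injective (deduplicate-! (≡.decSetoid _≟ⱽ_) (concatMap vars F)) sym _ _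

    open Encoding variableAt variableAt-injective

    private
      clauseAt-injective : ∀ {k l} → clauseAt k ≐ clauseAt l → k ≡ l
      clauseAt-injective = lookup-injective (deduplicate-! clausesDecSetoid F) ≐-sym _ _

      entry? : ∀ k b j → Dec (lit (j , b) ∈ₗ literals (clauseAt k))
      entry? k b j = lit (j , b) Lits.∈? literals (clauseAt k)

    initial : State (length cs) (length vs)
    initial = record { rows = ⊤ ; cols = ⊤ ; E = λ k b → ⁅ entry? k b ⁆? }

    private
      Row₀ : Fin (length cs) → Clause → Set a
      Row₀ = Row initial

      clauseAt∈F : ∀ k → clauseAt k ∈ᶜ F
      clauseAt∈F k = CardC.dedup⁻ F {clauseAt k} (∈⇒∈ᶜ {clauseAt k} (∈-lookup k))

      number : ∀ {C x} → C ∈ₗ F → x ∈ₗ literals C → ∃[ j ] var x ≡ variableAt j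
      number {C} C∈ x∈ = let v∈ = CardV.dedup⁺ (∈-concatMap⁺ vars (lose C∈ (∈-map⁺ var x∈)))
                     in index v∈ , lookup-index v∈

      row-clauseAt : ∀ k → Row₀ k (clauseAt k)
      row-clauseAt k = record
        { encode = λ x x∈ →
            let D , D∈ , (⊆D , _) = find {P = λ D → literals (clauseAt k) Lits.≐ literals D} (clauseAt∈F k)
                j , eq = number D∈ (⊆D x∈) ; x≡ = cong (_, proj₂ x) eq
            in (j , proj₂ x) , x≡ , ∈⊤ ,
               ∈-⁅⁆?⁺ (entry? k (proj₂ x)) (subst (_∈ₗ literals (clauseAt k)) x≡ x∈)
        ; decode = λ { (j , b) (_ , j∈) → ∈-⁅⁆?⁻ (entry? k b) j∈ }
        }

    initial-represents : Represents initial F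
    initial-represents = record
      { rowOf = λ C C∈ → let C∈cs = CardC.dedup⁺ {F} {C} (∈⇒∈ᶜ {C} C∈) in
          index C∈cs , ∈⊤ , row-≐ (≐-sym (lookup-index C∈cs)) (row-clauseAt (index C∈cs))
      ; clauseOf = λ k _ →
          let D , D∈ , eq = find {P = λ D → literals (clauseAt k) Lits.≐ literals D} (clauseAt∈F k)
          in D , D∈ , row-≐ eq (row-clauseAt k)
      }

    open Represents initial-represents
    open Row

    private
      initial-unsat : Rows.Unsat (E initial) ⊤ ⊤
      initial-unsat φ φ⊨ = proj₁ muF (ψ , λ {C} → satisfied {C})
        where
        ψ : V → Bool
        ψ = assignment φ
        satisfied : ∀ {C} → C ∈ᶜ F → ψ ⊨ C
        satisfied {C} C∈ =
          let D , D∈ , (_ , D⊆C) = find {P = λ D → literals C Lits.≐ literals D} C∈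
              k , k∈ , ρ = rowOf D D∈
              j , j∈ , j∈k = φ⊨ k k∈
          in lit (j , φ j) , D⊆C (decode ρ (j , φ j) (j∈ , j∈k)) , assignment-at φ j

      -- All copies of the clause are removed, up to equality of literals; removing one list entry
      -- might leave the same clause-set.
      others : Fin (length cs) → ClauseSet
      others k = filter (λ C → ¬? (literals C Lits.≐? literals (clauseAt k))) F

      others-satisfiable : ∀ k → Satisfiable (others k)
      others-satisfiable k = proj₂ muF (others k)
        (λ {C} C∈ → let D , D∈ , eq = find {P = λ D → literals C Lits.≐ literals D} C∈
                    in lose (proj₁ (∈-filter⁻ (λ C → ¬? (literals C Lits.≐? literals (clauseAt k))) {xs = F} D∈)) eq)
        (λ F⊆ → let D , D∈ , eq = find {P = λ D → literals (clauseAt k) Lits.≐ literals D}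
                                    (F⊆ {clauseAt k} (clauseAt∈F k))
                in proj₂ (∈-filter⁻ (λ C → ¬? (literals C Lits.≐? literals (clauseAt k))) {xs = F} D∈) (≐-sym eq))

      initial-minimal : ∀ k → ∃[ φ ] Rows.FalsifiesOnly (E initial) φ ⊤ ⊤ k
      initial-minimal k with ψ , ψ⊨ ← others-satisfiable k = ψ ∘ variableAt , only
        where
        only : Rows.FalsifiesOnly (E initial) (ψ ∘ variableAt) ⊤ ⊤ k
        only l l∈ l≢k with C , C∈ , ρ ← clauseOf l l∈
                      with x , x∈ , eq ← ψ⊨ {C} (∈⇒∈ᶜ {C} (∈-filter⁺ (λ C → ¬? (literals C Lits.≐? literals (clauseAt k))) C∈
                             λ C≐ → l≢k (clauseAt-injective (≐-trans
                               (row-unique (row-clauseAt l) ρ) C≐))))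
                      with (j , d) , refl , j∈ , j∈l ← encode ρ x x∈ =
          j , j∈ , subst (λ d → j ∈ E initial l d) (sym eq) j∈l

      initial-occurs : ∀ j → Rows.Occurs (E initial) ⊤ j
      initial-occurs j
        with C , C∈ , v∈ ← find (∈-concatMap⁻ vars {xs = F} (CardV.dedup⁻ (concatMap vars F) (∈-lookup j)))
        with (_ , b) , x∈ , refl ← ∈-map⁻ var v∈
        with k , k∈ , ρ ← rowOf C C∈ = k , b , k∈ , proj₂ (has ρ (j , b) x∈)

    initial-MU₂ : δ F ≡ + 2 → MU₂ initial
    initial-MU₂ δ≡2 = record
      { critical = record
        { unsat = initial-unsat
        ; minimal = λ {k} _ → initial-minimal k
        ; occurs = λ {j} _ → initial-occurs j
        }
      ; clash-free = λ {k} {j} {b} _ _ x y →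
          clash-free (clauseAt k) (∈-⁅⁆?⁻ (entry? k b) x) (∈-⁅⁆?⁻ (entry? k (not b)) y)
      ; deficiency = trans (∣⊤∣≡n _) (trans (i-j≡k⇒i≡k+j (length cs) (length vs) 2 δ≡2) (cong (λ k → 2 + k) (sym (∣⊤∣≡n _))))
      }

theorem74 : ∀ {a} {V : Set a} (_≟_ : DecidableEquality V) →
    let open ClauseSets _≟_ in
    ∀ (F : ClauseSet) → MU F → δ F ≡ + 2 →
    ∀ (G H : ClauseSet) → G ∈sDP F → H ∈sDP F → G ≅ H
theorem74 _≟_ F muF δ≡2 G H (_ , nonsingularG , _ , F⇝G , ≐G) (_ , nonsingularH , _ , F⇝H , ≐H) =
  let open Bridge _≟_
      open Initial F muF
      open Encoding variableAt variableAt-injective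
      mu = initial-MU₂ δ≡2
      S , toS , S-represents-G = reach-of-sDP mu initial-represents F⇝G ≐G nonsingularG
      T , toT , T-represents-H = reach-of-sDP mu initial-represents F⇝H ≐H nonsingularH
  in isomorphic S-represents-G T-represents-H (confluent _ mu ℕ.≤-refl toS toT)
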